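{- Let $G(V, E, w)$ be an undirected social network, let $N = \sum_{i\in V} w_{ii}$ and $W=\sum_{i<j} w_{ij}$, with $W>0$, let $\lambda = N/W$, and let $q = \max\left\{ 1-\frac{\sqrt{2}(2+\lambda)}{4},\, 0\right\}$. Then $\mathrm{IE}(q, 2-\sqrt{2})$ approximates the maximum revenue extracted from $G$ within a factor of at least $2\sqrt{2}(2-\sqrt{2})(\sqrt{2}-1) \approx 0.686$; that is, the expected revenue of $\mathrm{IE}(q,2-\sqrt2)$ is at least $2\sqrt{2}(2-\sqrt{2})(\sqrt{2}-1)\cdot R_{\max}(G)$.
   Context: An undirected social network $G(V,E,w)$ on a finite set $V$ of $n$ buyers has real weights $w_{ij} = w_{ji} \geq 0$ for distinct $i,j \in V$ (positive exactly on the edges) and a weight $w_{ii} \geq 0$ for each $i \in V$. Marketing strategies (Uniform Additive Model). A marketing strategy $(\vec{\pi},\vec{p})$ consists of a permutation $\vec{\pi}$ of $V$ ($\pi_i$ is the position of buyer $i$) and a vector $\vec{p}$ of pricing probabilities $p_i \in [1/2,1]$. Its expected revenue is $$R(\vec{\pi},\vec{p}) = \sum_{i\in V} p_i(1-p_i)\Big(w_{ii} + \sum_{j:\pi_j<\pi_i} p_j w_{ji}\Big),$$ and $R_{\max}(G) = \max_{(\vec{\pi},\vec{p})} R(\vec{\pi},\vec{p})$ is the maximum revenue of $G$. IE strategies. For $A \subseteq V$ and $p \in [1/2,1)$, $\mathrm{IE}(A,p)$ gives the product for free to the buyers in $A$ and then approaches the buyers in $V\setminus A$ in uniformly random order with pricing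 probability $p$. Its expected revenue is $$R_{\mathrm{IE}}(A,p) = p(1-p)\sum_{i\in V\setminus A}\Big(w_{ii} + \sum_{j\in A} w_{ji} + \sum_{j\in V\setminus A,\ j\neq i} \frac{p\,w_{ji}}{2}\Big).$$ For $q\in[0,1]$, $\mathrm{IE}(q,p)$ denotes the strategy $\mathrm{IE}(A,p)$ where $A$ is a random set containing each buyer independently with probability $q$; its expected revenue is $\mathbb{E}_A[R_{\mathrm{IE}}(A,p)]$. -}

module Defs where

open import Algebra.Bundles using (CommutativeRing)
import Algebra.Definitions.RawMonoid as RawMonoid
open import Data.Bool.Base using (if_then_else_)
open import Data.Fin.Base as Fin using (Fin)
import Data.Fin.Properties as Fin
open import Data.Fin.Permutation using (Permutation′; _⟨$⟩ʳ_)
open import Data.Fin.Subset using (Subset; inside; outside)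
open import Data.Fin.Subset.Properties using (_∈?_)
open import Data.Integer.Base as ℤ using (+_; +[1+_])
import Data.Integer.Properties as ℤ
open import Data.Nat.Base as ℕ using (ℕ; zero; suc; s≤s; z≤n)
open import Data.Nat.Coprimality using (1-coprimeTo)
import Data.Nat.Properties as ℕ
open import Data.Product using (∃; _×_; _,_)
open import Data.Rational.Base as ℚ using (ℚ; 0ℚ; 1ℚ; ½; mkℚ; *≤*; *<*)
import Data.Rational.Properties as ℚ
import Data.Rational.Unnormalised.Base as ℚᵘ
import Data.Rational.Unnormalised.Properties as ℚᵘ
open import Data.Rational.Solver using (module +-*-Solver)
open import Data.Sum.Base using (inj₁; inj₂)
open import Data.Vec.Base using ([]; _∷_)
open import Function.Base using (_∘_)
open import Function.Bundles using (_⇔_)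
open import Level using (0ℓ)
open import Relation.Binary.Core using (Rel)
open import Relation.Binary.PropositionalEquality
open import Relation.Nullary using (Dec; yes; no; does; ¬_; ¬?; _×-dec_)
open import Relation.Nullary.Decidable using (from-yes)
open import Relation.Unary using (Pred; Decidable)

0<½ : 0ℚ ℚ.< ½
0<½ = ℚ.positive⁻¹ ½

pos*pos : ∀ {p q} → 0ℚ ℚ.< p → 0ℚ ℚ.< q → 0ℚ ℚ.< p ℚ.* q
pos*pos {p} {q} 0<p 0<q = subst (ℚ._< p ℚ.* q) (ℚ.*-zeroʳ p)
  (ℚ.*-monoʳ-<-pos p {{ℚ.positive 0<p}} 0<q)

*-mono-≤ : ∀ {p q r s} → 0ℚ ℚ.≤ q → 0ℚ ℚ.≤ r →
           p ℚ.≤ q → r ℚ.≤ s → p ℚ.* r ℚ.≤ q ℚ.* s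
*-mono-≤ {q = q} {r = r} 0≤q 0≤r p≤q r≤s = ℚ.≤-trans
  (ℚ.*-monoʳ-≤-nonNeg r {{ℚ.nonNegative 0≤r}} p≤q)
  (ℚ.*-monoˡ-≤-nonNeg q {{ℚ.nonNegative 0≤q}} r≤s)

½+½ : ∀ ε → ½ ℚ.* ε ℚ.+ ½ ℚ.* ε ≡ ε
½+½ = solve 1 (λ ε → con ½ :* ε :+ con ½ :* ε := ε) refl
  where open +-*-Solver

recip : ∀ p → 0ℚ ℚ.< p → ℚ
recip p 0<p = (ℚ.1/ p) {{ℚ.>-nonZero 0<p}}

*-recip : ∀ p 0<p → p ℚ.* recip p 0<p ≡ 1ℚ
*-recip p 0<p = ℚ.*-inverseʳ p {{ℚ.>-nonZero 0<p}}

recip>0 : ∀ p 0<p → 0ℚ ℚ.< recip p 0<p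
recip>0 p@(mkℚ (+ zero) _ _) (*<* (ℤ.+<+ ()))
recip>0 p@(mkℚ (+[1+ _ ]) _ _) 0<p = ℚ.positive⁻¹ (recip p 0<p)
recip>0 p@(mkℚ (ℤ.-[1+ _ ]) _ _) (*<* ())

shrink : ∀ {B ε} → 0ℚ ℚ.< B → 0ℚ ℚ.< ε →
         ∃ λ δ → 0ℚ ℚ.< δ × B ℚ.* δ ≡ ½ ℚ.* ε
shrink {B} {ε} 0<B 0<ε =
  ½ ℚ.* ε ℚ.* recip B 0<B , pos*pos (pos*pos 0<½ 0<ε) (recip>0 B 0<B) ,
  (begin
    B ℚ.* (½ ℚ.* ε ℚ.* recip B 0<B)  ≡⟨ rearrange B ε (recip B 0<B) ⟩
    ½ ℚ.* ε ℚ.* (B ℚ.* recip B 0<B)  ≡⟨ cong (½ ℚ.* ε ℚ.*_) (*-recip B 0<B) ⟩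
    ½ ℚ.* ε ℚ.* 1ℚ                   ≡⟨ ℚ.*-identityʳ _ ⟩
    ½ ℚ.* ε                          ∎)
  where
  open ≡-Reasoning
  rearrange : ∀ B ε r → B ℚ.* (½ ℚ.* ε ℚ.* r) ≡ ½ ℚ.* ε ℚ.* (B ℚ.* r)
  rearrange = solve 3 (λ B ε r → B :* (con ½ :* ε :* r) := con ½ :* ε :* (B :* r)) refl
    where open +-*-Solver

≤-addˡ : ∀ p q {r} → p ℚ.≤ q ℚ.+ r → p ℚ.- q ℚ.≤ r
≤-addˡ p q {r} p≤q+r = subst (p ℚ.- q ℚ.≤_)
  (solve 2 (λ q r → (q :+ r) :- q := r) refl q r)
  (ℚ.+-monoˡ-≤ (ℚ.- q) p≤q+r)
  where open +-*-Solver

≤-subˡ : ∀ p q {r} → p ℚ.- q ℚ.≤ r → p ℚ.≤ q ℚ.+ r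
≤-subˡ p q {r} p-q≤r = subst (ℚ._≤ q ℚ.+ r)
  (solve 2 (λ p q → q :+ (p :- q) := p) refl p q)
  (ℚ.+-monoʳ-≤ q p-q≤r)
  where open +-*-Solver

∣-∣-comm : ∀ p q → ℚ.∣ p ℚ.- q ∣ ≡ ℚ.∣ q ℚ.- p ∣
∣-∣-comm p q = trans
  (cong ℚ.∣_∣ (solve 2 (λ p q → p :- q := :- (q :- p)) refl p q))
  (ℚ.∣-p∣≡∣p∣ (q ℚ.- p))
  where open +-*-Solver

p≤∣p∣ : ∀ p → p ℚ.≤ ℚ.∣ p ∣
p≤∣p∣ p with ℚ.≤-total 0ℚ p
... | inj₁ 0≤p = ℚ.≤-reflexive (sym (ℚ.0≤p⇒∣p∣≡p 0≤p))
... | inj₂ p≤0 = ℚ.≤-trans p≤0 (ℚ.0≤∣p∣ p)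

∣-∣≤-intro : ∀ p q {ε} → p ℚ.≤ q ℚ.+ ε → q ℚ.≤ p ℚ.+ ε → ℚ.∣ p ℚ.- q ∣ ℚ.≤ ε
∣-∣≤-intro p q {ε} p≤q+ε q≤p+ε with ℚ.∣p∣≡p∨∣p∣≡-p (p ℚ.- q)
... | inj₁ eq = subst (ℚ._≤ ε) (sym eq) (≤-addˡ p q p≤q+ε)
... | inj₂ eq = subst (ℚ._≤ ε)
  (trans (solve 2 (λ p q → q :- p := :- (p :- q)) refl p q) (sym eq))
  (≤-addˡ q p q≤p+ε)
  where open +-*-Solver

∣-∣≤-elim : ∀ p q {ε} → ℚ.∣ p ℚ.- q ∣ ℚ.≤ ε → p ℚ.≤ q ℚ.+ ε
∣-∣≤-elim p q h = ≤-subˡ p q (ℚ.≤-trans (p≤∣p∣ (p ℚ.- q)) h)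

∣-∣-+ : ∀ a b c d {δ ε} → ℚ.∣ a ℚ.- c ∣ ℚ.≤ δ → ℚ.∣ b ℚ.- d ∣ ℚ.≤ ε →
        ℚ.∣ (a ℚ.+ b) ℚ.- (c ℚ.+ d) ∣ ℚ.≤ δ ℚ.+ ε
∣-∣-+ a b c d {δ} {ε} h k = begin
  ℚ.∣ (a ℚ.+ b) ℚ.- (c ℚ.+ d) ∣          ≡⟨ cong ℚ.∣_∣ (split a b c d) ⟩
  ℚ.∣ (a ℚ.- c) ℚ.+ (b ℚ.- d) ∣          ≤⟨ ℚ.∣p+q∣≤∣p∣+∣q∣ (a ℚ.- c) (b ℚ.- d) ⟩
  ℚ.∣ a ℚ.- c ∣ ℚ.+ ℚ.∣ b ℚ.- d ∣        ≤⟨ ℚ.+-mono-≤ h k ⟩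
  δ ℚ.+ ε                                ∎
  where
  open ℚ.≤-Reasoning
  split : ∀ a b c d → (a ℚ.+ b) ℚ.- (c ℚ.+ d) ≡ (a ℚ.- c) ℚ.+ (b ℚ.- d)
  split = solve 4 (λ a b c d → (a :+ b) :- (c :+ d) := (a :- c) :+ (b :- d)) refl
    where open +-*-Solver

∣-∣-neg : ∀ a b {ε} → ℚ.∣ a ℚ.- b ∣ ℚ.≤ ε → ℚ.∣ ℚ.- a ℚ.- ℚ.- b ∣ ℚ.≤ ε
∣-∣-neg a b {ε} = subst (ℚ._≤ ε)
  (trans (∣-∣-comm a b)
    (cong ℚ.∣_∣ (solve 2 (λ a b → b :- a := :- a :- :- b) refl a b)))
  where open +-*-Solver

∣-∣-* : ∀ a b c d {A B δ γ} → 0ℚ ℚ.≤ δ → 0ℚ ℚ.≤ A →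
        ℚ.∣ c ∣ ℚ.≤ A → ℚ.∣ b ∣ ℚ.≤ B →
        ℚ.∣ a ℚ.- c ∣ ℚ.≤ δ → ℚ.∣ b ℚ.- d ∣ ℚ.≤ γ →
        ℚ.∣ a ℚ.* b ℚ.- c ℚ.* d ∣ ℚ.≤ B ℚ.* δ ℚ.+ A ℚ.* γ
∣-∣-* a b c d {A} {B} {δ} {γ} 0≤δ 0≤A c≤A b≤B ac bd = begin
  ℚ.∣ a ℚ.* b ℚ.- c ℚ.* d ∣
    ≡⟨ cong ℚ.∣_∣ (split a b c d) ⟩
  ℚ.∣ (a ℚ.- c) ℚ.* b ℚ.+ c ℚ.* (b ℚ.- d) ∣
    ≤⟨ ℚ.∣p+q∣≤∣p∣+∣q∣ ((a ℚ.- c) ℚ.* b) (c ℚ.* (b ℚ.- d)) ⟩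
  ℚ.∣ (a ℚ.- c) ℚ.* b ∣ ℚ.+ ℚ.∣ c ℚ.* (b ℚ.- d) ∣
    ≡⟨ cong₂ ℚ._+_ (ℚ.∣p*q∣≡∣p∣*∣q∣ (a ℚ.- c) b) (ℚ.∣p*q∣≡∣p∣*∣q∣ c (b ℚ.- d)) ⟩
  ℚ.∣ a ℚ.- c ∣ ℚ.* ℚ.∣ b ∣ ℚ.+ ℚ.∣ c ∣ ℚ.* ℚ.∣ b ℚ.- d ∣
    ≤⟨ ℚ.+-mono-≤ (*-mono-≤ 0≤δ (ℚ.0≤∣p∣ b) ac b≤B)
                  (*-mono-≤ 0≤A (ℚ.0≤∣p∣ (b ℚ.- d)) c≤A bd) ⟩
  δ ℚ.* B ℚ.+ A ℚ.* γ
    ≡⟨ cong (ℚ._+ A ℚ.* γ) (ℚ.*-comm δ B) ⟩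
  B ℚ.* δ ℚ.+ A ℚ.* γ ∎
  where
  open ℚ.≤-Reasoning
  split : ∀ a b c d → a ℚ.* b ℚ.- c ℚ.* d ≡ (a ℚ.- c) ℚ.* b ℚ.+ c ℚ.* (b ℚ.- d)
  split = solve 4 (λ a b c d → a :* b :- c :* d := (a :- c) :* b :+ c :* (b :- d)) refl
    where open +-*-Solver

⊔-+ : ∀ a b c d {ε} → a ℚ.≤ c ℚ.+ ε → b ℚ.≤ d ℚ.+ ε →
      a ℚ.⊔ b ℚ.≤ (c ℚ.⊔ d) ℚ.+ ε
⊔-+ a b c d {ε} h k = ℚ.⊔-lub
  (ℚ.≤-trans h (ℚ.+-monoˡ-≤ ε (ℚ.p≤p⊔q c d)))
  (ℚ.≤-trans k (ℚ.+-monoˡ-≤ ε (ℚ.p≤q⊔p c d)))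

-- Real numbers as Cauchy sequences of rationals, with equality _≃_: operations act termwise.

IsCauchy : (ℕ → ℚ) → Set
IsCauchy x = ∀ ε → 0ℚ ℚ.< ε →
  ∃ λ k → ∀ m n → k ℕ.≤ m → k ℕ.≤ n → ℚ.∣ x m ℚ.- x n ∣ ℚ.≤ ε

record ℝ : Set where
  constructor mkℝ
  field
    seq    : ℕ → ℚ
    cauchy : IsCauchy seq

open ℝ public

infix 4 _≃_ _≤_ _<_

_≃_ : Rel ℝ 0ℓ
x ≃ y = ∀ ε → 0ℚ ℚ.< ε →
  ∃ λ k → ∀ n → k ℕ.≤ n → ℚ.∣ seq x n ℚ.- seq y n ∣ ℚ.≤ ε

_≤_ : Rel ℝ 0ℓ
x ≤ y = ∀ ε → 0ℚ ℚ.< ε →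
  ∃ λ k → ∀ n → k ℕ.≤ n → seq x n ℚ.≤ seq y n ℚ.+ ε

_<_ : Rel ℝ 0ℓ
x < y = ∃ λ ε → 0ℚ ℚ.< ε ×
  (∃ λ k → ∀ n → k ℕ.≤ n → seq x n ℚ.+ ε ℚ.≤ seq y n)

⊔≤ˡ : ∀ {a b c} → a ℕ.⊔ b ℕ.≤ c → a ℕ.≤ c
⊔≤ˡ {a} {b} = ℕ.m⊔n≤o⇒m≤o a b

⊔≤ʳ : ∀ {a b c} → a ℕ.⊔ b ℕ.≤ c → b ℕ.≤ c
⊔≤ʳ {a} {b} = ℕ.m⊔n≤o⇒n≤o a b

bounded : ∀ x → ∃ λ B → 0ℚ ℚ.< B ×
          (∃ λ k → ∀ n → k ℕ.≤ n → ℚ.∣ seq x n ∣ ℚ.≤ B)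
bounded x =
  let k , h = cauchy x 1ℚ (ℚ.positive⁻¹ 1ℚ)
  in ℚ.∣ seq x k ∣ ℚ.+ 1ℚ ,
  ℚ.+-mono-≤-< (ℚ.0≤∣p∣ (seq x k)) (ℚ.positive⁻¹ 1ℚ) ,
  k , λ n k≤n → begin
    ℚ.∣ seq x n ∣
      ≡⟨ cong ℚ.∣_∣ (split (seq x n) (seq x k)) ⟩
    ℚ.∣ seq x k ℚ.+ (seq x n ℚ.- seq x k) ∣
      ≤⟨ ℚ.∣p+q∣≤∣p∣+∣q∣ (seq x k) (seq x n ℚ.- seq x k) ⟩
    ℚ.∣ seq x k ∣ ℚ.+ ℚ.∣ seq x n ℚ.- seq x k ∣
      ≤⟨ ℚ.+-monoʳ-≤ ℚ.∣ seq x k ∣ (h n k k≤n ℕ.≤-refl) ⟩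
    ℚ.∣ seq x k ∣ ℚ.+ 1ℚ ∎
  where
  open ℚ.≤-Reasoning
  split : ∀ a b → a ≡ b ℚ.+ (a ℚ.- b)
  split = solve 2 (λ a b → a := b :+ (a :- b)) refl
    where open +-*-Solver

∣p-p∣≤ : ∀ p {ε} → 0ℚ ℚ.< ε → ℚ.∣ p ℚ.- p ∣ ℚ.≤ ε
∣p-p∣≤ p {ε} 0<ε = subst (λ z → ℚ.∣ z ∣ ℚ.≤ ε) (sym (ℚ.+-inverseʳ p)) (ℚ.<⇒≤ 0<ε)

oneSided : ∀ {x : ℕ → ℚ} →
  (∀ ε → 0ℚ ℚ.< ε → ∃ λ k → ∀ m n → k ℕ.≤ m → k ℕ.≤ n → x m ℚ.≤ x n ℚ.+ ε) →
  IsCauchy x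
oneSided {x} h ε 0<ε =
  let k , g = h ε 0<ε
  in k , λ m n k≤m k≤n → ∣-∣≤-intro (x m) (x n) (g m n k≤m k≤n) (g n m k≤n k≤m)

fromℚ : ℚ → ℝ
fromℚ q = mkℝ (λ _ → q) λ ε 0<ε → 0 , λ _ _ _ _ → ∣p-p∣≤ q 0<ε

infix  8 -_
infixl 7 _*_
infixl 6 _+_ _-_ _⊔_

_+_ : ℝ → ℝ → ℝ
x + y = mkℝ (λ n → seq x n ℚ.+ seq y n) +-cauchy
  where
  +-cauchy : IsCauchy (λ n → seq x n ℚ.+ seq y n)
  +-cauchy ε 0<ε =
    let k , f = cauchy x (½ ℚ.* ε) (pos*pos 0<½ 0<ε)
        l , g = cauchy y (½ ℚ.* ε) (pos*pos 0<½ 0<ε)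
    in k ℕ.⊔ l , λ m n m≥ n≥ →
    subst (ℚ.∣ (seq x m ℚ.+ seq y m) ℚ.- (seq x n ℚ.+ seq y n) ∣ ℚ.≤_) (½+½ ε)
      (∣-∣-+ (seq x m) (seq y m) (seq x n) (seq y n)
        (f m n (⊔≤ˡ m≥) (⊔≤ˡ n≥)) (g m n (⊔≤ʳ {k} m≥) (⊔≤ʳ {k} n≥)))

-_ : ℝ → ℝ
- x = mkℝ (λ n → ℚ.- seq x n) neg-cauchy
  where
  neg-cauchy : IsCauchy (λ n → ℚ.- seq x n)
  neg-cauchy ε 0<ε =
    let k , f = cauchy x ε 0<ε
    in k , λ m n m≥ n≥ → ∣-∣-neg (seq x m) (seq x n) (f m n m≥ n≥)

_-_ : ℝ → ℝ → ℝ
x - y = x + (- y)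

_*_ : ℝ → ℝ → ℝ
x * y = mkℝ (λ n → seq x n ℚ.* seq y n) *-cauchy
  where
  *-cauchy : IsCauchy (λ n → seq x n ℚ.* seq y n)
  *-cauchy ε 0<ε =
    let A , 0<A , a , x≤A = bounded x
        B , 0<B , b , y≤B = bounded y
        δ , 0<δ , Bδ = shrink 0<B 0<ε
        γ , 0<γ , Aγ = shrink 0<A 0<ε
        k , f = cauchy x δ 0<δ
        l , g = cauchy y γ 0<γ
    in (a ℕ.⊔ b) ℕ.⊔ (k ℕ.⊔ l) , λ m n m≥ n≥ →
    subst (ℚ.∣ seq x m ℚ.* seq y m ℚ.- seq x n ℚ.* seq y n ∣ ℚ.≤_)
      (trans (cong₂ ℚ._+_ Bδ Aγ) (½+½ ε))
      (∣-∣-* (seq x m) (seq y m) (seq x n) (seq y n) (ℚ.<⇒≤ 0<δ) (ℚ.<⇒≤ 0<A)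
        (x≤A n (⊔≤ˡ (⊔≤ˡ n≥))) (y≤B m (⊔≤ʳ {a} (⊔≤ˡ m≥)))
        (f m n (⊔≤ˡ (⊔≤ʳ {a ℕ.⊔ b} m≥)) (⊔≤ˡ (⊔≤ʳ {a ℕ.⊔ b} n≥)))
        (g m n (⊔≤ʳ {k} (⊔≤ʳ {a ℕ.⊔ b} m≥)) (⊔≤ʳ {k} (⊔≤ʳ {a ℕ.⊔ b} n≥))))

_⊔_ : ℝ → ℝ → ℝ
x ⊔ y = mkℝ (λ n → seq x n ℚ.⊔ seq y n) (oneSided ⊔-cauchy)
  where
  ⊔-cauchy : ∀ ε → 0ℚ ℚ.< ε → ∃ λ k → ∀ m n → k ℕ.≤ m → k ℕ.≤ n →
             seq x m ℚ.⊔ seq y m ℚ.≤ (seq x n ℚ.⊔ seq y n) ℚ.+ ε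
  ⊔-cauchy ε 0<ε =
    let k , f = cauchy x ε 0<ε
        l , g = cauchy y ε 0<ε
    in k ℕ.⊔ l , λ m n m≥ n≥ →
    ⊔-+ (seq x m) (seq y m) (seq x n) (seq y n)
      (∣-∣≤-elim (seq x m) (seq x n) (f m n (⊔≤ˡ m≥) (⊔≤ˡ n≥)))
      (∣-∣≤-elim (seq y m) (seq y n) (g m n (⊔≤ʳ {k} m≥) (⊔≤ʳ {k} n≥)))

0ℝ 1ℝ 2ℝ : ℝ
0ℝ = fromℚ 0ℚ
1ℝ = fromℚ 1ℚ
2ℝ = fromℚ (+ 2 ℚ./ 1)

≃-refl : ∀ {x} → x ≃ x
≃-refl {x} ε 0<ε = 0 , λ n _ → ∣p-p∣≤ (seq x n) 0<ε

≃-sym : ∀ {x y} → x ≃ y → y ≃ x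
≃-sym {x} {y} x≃y ε 0<ε =
  let k , f = x≃y ε 0<ε
  in k , λ n n≥ → subst (ℚ._≤ ε) (∣-∣-comm (seq x n) (seq y n)) (f n n≥)

≃-trans : ∀ {x y z} → x ≃ y → y ≃ z → x ≃ z
≃-trans {x} {y} {z} x≃y y≃z ε 0<ε =
  let k , f = x≃y (½ ℚ.* ε) (pos*pos 0<½ 0<ε)
      l , g = y≃z (½ ℚ.* ε) (pos*pos 0<½ 0<ε)
  in k ℕ.⊔ l , λ n n≥ →
  subst₂ ℚ._≤_ (cong ℚ.∣_∣ (telescope (seq x n) (seq y n) (seq z n))) (½+½ ε)
    (∣-∣-+ (seq x n) (seq y n) (seq y n) (seq z n) (f n (⊔≤ˡ n≥)) (g n (⊔≤ʳ {k} n≥)))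
  where
  telescope : ∀ a b c → (a ℚ.+ b) ℚ.- (b ℚ.+ c) ≡ a ℚ.- c
  telescope = solve 3 (λ a b c → (a :+ b) :- (b :+ c) := a :- c) refl
    where open +-*-Solver

pointwise : ∀ x y → (∀ n → seq x n ≡ seq y n) → x ≃ y
pointwise x y x≡y ε 0<ε = 0 , λ n _ →
  subst (λ z → ℚ.∣ seq x n ℚ.- z ∣ ℚ.≤ ε) (x≡y n) (∣p-p∣≤ (seq x n) 0<ε)

+-cong : ∀ {x y u v} → x ≃ y → u ≃ v → x + u ≃ y + v
+-cong {x} {y} {u} {v} x≃y u≃v ε 0<ε =
  let k , f = x≃y (½ ℚ.* ε) (pos*pos 0<½ 0<ε)
      l , g = u≃v (½ ℚ.* ε) (pos*pos 0<½ 0<ε)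
  in k ℕ.⊔ l , λ n n≥ →
  subst (ℚ.∣ (seq x n ℚ.+ seq u n) ℚ.- (seq y n ℚ.+ seq v n) ∣ ℚ.≤_) (½+½ ε)
    (∣-∣-+ (seq x n) (seq u n) (seq y n) (seq v n) (f n (⊔≤ˡ n≥)) (g n (⊔≤ʳ {k} n≥)))

-‿cong : ∀ {x y} → x ≃ y → - x ≃ - y
-‿cong {x} {y} x≃y ε 0<ε =
  let k , f = x≃y ε 0<ε
  in k , λ n n≥ → ∣-∣-neg (seq x n) (seq y n) (f n n≥)

*-cong : ∀ {x y u v} → x ≃ y → u ≃ v → x * u ≃ y * v
*-cong {x} {y} {u} {v} x≃y u≃v ε 0<ε =
  let A , 0<A , a , y≤A = bounded y
      B , 0<B , b , u≤B = bounded u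
      δ , 0<δ , Bδ = shrink 0<B 0<ε
      γ , 0<γ , Aγ = shrink 0<A 0<ε
      k , f = x≃y δ 0<δ
      l , g = u≃v γ 0<γ
  in (a ℕ.⊔ b) ℕ.⊔ (k ℕ.⊔ l) , λ n n≥ →
  subst (ℚ.∣ seq x n ℚ.* seq u n ℚ.- seq y n ℚ.* seq v n ∣ ℚ.≤_)
    (trans (cong₂ ℚ._+_ Bδ Aγ) (½+½ ε))
    (∣-∣-* (seq x n) (seq u n) (seq y n) (seq v n) (ℚ.<⇒≤ 0<δ) (ℚ.<⇒≤ 0<A)
      (y≤A n (⊔≤ˡ (⊔≤ˡ n≥))) (u≤B n (⊔≤ʳ {a} (⊔≤ˡ n≥)))
      (f n (⊔≤ˡ (⊔≤ʳ {a ℕ.⊔ b} n≥))) (g n (⊔≤ʳ {k} (⊔≤ʳ {a ℕ.⊔ b} n≥))))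

ℝ-commutativeRing : CommutativeRing 0ℓ 0ℓ
ℝ-commutativeRing = record
  { Carrier = ℝ
  ; _≈_ = _≃_
  ; _+_ = _+_
  ; _*_ = _*_
  ; -_  = -_
  ; 0#  = 0ℝ
  ; 1#  = 1ℝ
  ; isCommutativeRing = record
    { isRing = record
      { +-isAbelianGroup = record
        { isGroup = record
          { isMonoid = record
            { isSemigroup = record
              { isMagma = record
                { isEquivalence = ≃-isEquivalence
                ; ∙-cong = λ {x} {y} {u} {v} → +-cong {x} {y} {u} {v}
                }
              ; assoc = λ x y z → pointwise ((x + y) + z) (x + (y + z)) λ n → ℚ.+-assoc (seq x n) (seq y n) (seq z n)
              }
            ; identity = (λ x → pointwise (0ℝ + x) x λ n → ℚ.+-identityˡ (seq x n))
                       , (λ x → pointwise (x + 0ℝ) x λ n → ℚ.+-identityʳ (seq x n))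
            }
          ; inverse = (λ x → pointwise (- x + x) 0ℝ λ n → ℚ.+-inverseˡ (seq x n))
                    , (λ x → pointwise (x + - x) 0ℝ λ n → ℚ.+-inverseʳ (seq x n))
          ; ⁻¹-cong = λ {x} {y} → -‿cong {x} {y}
          }
        ; comm = λ x y → pointwise (x + y) (y + x) λ n → ℚ.+-comm (seq x n) (seq y n)
        }
      ; *-cong = λ {x} {y} {u} {v} → *-cong {x} {y} {u} {v}
      ; *-assoc = λ x y z → pointwise ((x * y) * z) (x * (y * z)) λ n → ℚ.*-assoc (seq x n) (seq y n) (seq z n)
      ; *-identity = (λ x → pointwise (1ℝ * x) x λ n → ℚ.*-identityˡ (seq x n))
                   , (λ x → pointwise (x * 1ℝ) x λ n → ℚ.*-identityʳ (seq x n))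
      ; distrib = (λ x y z → pointwise (x * (y + z)) (x * y + x * z) λ n → ℚ.*-distribˡ-+ (seq x n) (seq y n) (seq z n))
                , (λ x y z → pointwise ((y + z) * x) (y * x + z * x) λ n → ℚ.*-distribʳ-+ (seq x n) (seq y n) (seq z n))
      }
    ; *-comm = λ x y → pointwise (x * y) (y * x) λ n → ℚ.*-comm (seq x n) (seq y n)
    }
  }
  where
  open import Relation.Binary.Structures using (IsEquivalence)
  ≃-isEquivalence : IsEquivalence _≃_
  ≃-isEquivalence = record
    { refl  = λ {x} → ≃-refl {x}
    ; sym   = λ {x} {y} → ≃-sym {x} {y}
    ; trans = λ {x} {y} {z} → ≃-trans {x} {y} {z}
    }

0<⊔ : ∀ {ε} p → 0ℚ ℚ.< ε → 0ℚ ℚ.< p ℚ.⊔ ε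
0<⊔ {ε} p 0<ε = ℚ.<-≤-trans 0<ε (ℚ.p≤q⊔p p ε)

recip-≤ : ∀ {p q η ε} (0<p : 0ℚ ℚ.< p) (0<q : 0ℚ ℚ.< q) → 0ℚ ℚ.< η → 0ℚ ℚ.< ε →
          η ℚ.≤ p → η ℚ.≤ q → q ℚ.≤ p ℚ.+ η ℚ.* η ℚ.* ε →
          recip p 0<p ℚ.≤ recip q 0<q ℚ.+ ε
recip-≤ {p} {q} {η} {ε} 0<p 0<q 0<η 0<ε η≤p η≤q q≤p+η²ε =
  ℚ.*-cancelˡ-≤-pos (p ℚ.* q) {{ℚ.positive (pos*pos 0<p 0<q)}} (begin
    p ℚ.* q ℚ.* p⁻¹                   ≡⟨ swap p q p⁻¹ ⟩
    q ℚ.* (p ℚ.* p⁻¹)                 ≡⟨ cong (q ℚ.*_) (*-recip p 0<p) ⟩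
    q ℚ.* 1ℚ                          ≡⟨ ℚ.*-identityʳ q ⟩
    q                                 ≤⟨ q≤p+η²ε ⟩
    p ℚ.+ η ℚ.* η ℚ.* ε               ≤⟨ ℚ.+-monoʳ-≤ p (ℚ.*-monoʳ-≤-nonNeg ε {{ℚ.nonNegative (ℚ.<⇒≤ 0<ε)}}
                                           (*-mono-≤ (ℚ.<⇒≤ 0<p) (ℚ.<⇒≤ 0<η) η≤p η≤q)) ⟩
    p ℚ.+ p ℚ.* q ℚ.* ε               ≡⟨ cong (ℚ._+ p ℚ.* q ℚ.* ε) (ℚ.*-identityʳ p) ⟨
    p ℚ.* 1ℚ ℚ.+ p ℚ.* q ℚ.* ε        ≡⟨ cong (λ z → p ℚ.* z ℚ.+ p ℚ.* q ℚ.* ε) (*-recip q 0<q) ⟨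
    p ℚ.* (q ℚ.* q⁻¹) ℚ.+ p ℚ.* q ℚ.* ε ≡⟨ factor p q q⁻¹ ε ⟩
    p ℚ.* q ℚ.* (q⁻¹ ℚ.+ ε)           ∎)
  where
  open ℚ.≤-Reasoning
  p⁻¹ = recip p 0<p
  q⁻¹ = recip q 0<q
  swap : ∀ p q r → p ℚ.* q ℚ.* r ≡ q ℚ.* (p ℚ.* r)
  swap = solve 3 (λ p q r → p :* q :* r := q :* (p :* r)) refl
    where open +-*-Solver
  factor : ∀ p q r ε → p ℚ.* (q ℚ.* r) ℚ.+ p ℚ.* q ℚ.* ε ≡ p ℚ.* q ℚ.* (r ℚ.+ ε)
  factor = solve 4 (λ p q r ε → p :* (q :* r) :+ p :* q :* ε := p :* q :* (r :+ ε)) refl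
    where open +-*-Solver

-- The positivity proof supplies ε with ε ≤ seq x n eventually, so
-- seq x n ⊔ ε is eventually seq x n and is positive at every n.
recipℝ : ∀ x → 0ℝ < x → ℝ
recipℝ x (ε , 0<ε , _) = mkℝ r (oneSided r-cauchy)
  where
  r : ℕ → ℚ
  r n = recip (seq x n ℚ.⊔ ε) (0<⊔ (seq x n) 0<ε)
  r-cauchy : ∀ δ → 0ℚ ℚ.< δ → ∃ λ k → ∀ m n → k ℕ.≤ m → k ℕ.≤ n → r m ℚ.≤ r n ℚ.+ δ
  r-cauchy δ 0<δ =
    let k , f = cauchy x (ε ℚ.* ε ℚ.* δ) (pos*pos (pos*pos 0<ε 0<ε) 0<δ)
    in k , λ m n m≥ n≥ →
    recip-≤ (0<⊔ (seq x m) 0<ε) (0<⊔ (seq x n) 0<ε) 0<ε 0<δ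
      (ℚ.p≤q⊔p (seq x m) ε) (ℚ.p≤q⊔p (seq x n) ε)
      (⊔-+ (seq x n) ε (seq x m) ε (∣-∣≤-elim (seq x n) (seq x m) (f n m n≥ m≥))
        (subst (ℚ._≤ ε ℚ.+ ε ℚ.* ε ℚ.* δ) (ℚ.+-identityʳ ε)
          (ℚ.+-monoʳ-≤ ε (ℚ.<⇒≤ (pos*pos (pos*pos 0<ε 0<ε) 0<δ)))))

*-recipℝ : ∀ x (0<x : 0ℝ < x) → x * recipℝ x 0<x ≃ 1ℝ
*-recipℝ x (ε , 0<ε , k , f) δ 0<δ = k , λ n n≥ →
  subst (λ z → ℚ.∣ z ℚ.- 1ℚ ∣ ℚ.≤ δ) (sym (inverse n n≥)) (∣p-p∣≤ 1ℚ 0<δ)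
  where
  inverse : ∀ n → k ℕ.≤ n →
    seq x n ℚ.* recip (seq x n ℚ.⊔ ε) (0<⊔ (seq x n) 0<ε) ≡ 1ℚ
  inverse n n≥ = trans
    (cong (ℚ._* recip (seq x n ℚ.⊔ ε) (0<⊔ (seq x n) 0<ε))
      (sym (ℚ.p≥q⇒p⊔q≡p (subst (ℚ._≤ seq x n) (ℚ.+-identityˡ ε) (f n n≥)))))
    (*-recip (seq x n ℚ.⊔ ε) (0<⊔ (seq x n) 0<ε))

-- √2 by bisection: (√2-seq n)² ≤ 2 < (√2-seq n + ½^ n)²

½^_ : ℕ → ℚ
½^ zero  = 1ℚ
½^ suc n = ½ ℚ.* ½^ n

2ℚ : ℚ
2ℚ = + 2 ℚ./ 1

√2-seq : ℕ → ℚ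
√2-seq zero    = 1ℚ
√2-seq (suc n) =
  let x = √2-seq n
      y = x ℚ.+ ½^ suc n
  in if does (y ℚ.* y ℚ.≤? 2ℚ) then y else x

if-elim : ∀ {A P : Set} (Q : A → Set) (d : Dec P) {a b} →
          (P → Q a) → (¬ P → Q b) → Q (if does d then a else b)
if-elim Q (yes p) f g = f p
if-elim Q (no ¬p) f g = g ¬p

½^>0 : ∀ n → 0ℚ ℚ.< ½^ n
½^>0 zero    = ℚ.positive⁻¹ 1ℚ
½^>0 (suc n) = pos*pos 0<½ (½^>0 n)

1/suc : ℕ → ℚ
1/suc n = mkℚ (+ 1) n (1-coprimeTo (suc n))

½*1/suc : ∀ n → ½ ℚ.* 1/suc n ℚ.≤ 1/suc (suc n)
½*1/suc n = ℚ.toℚᵘ-cancel-≤ (ℚᵘ.≤-respˡ-≃ (ℚᵘ.≃-sym (ℚ.toℚᵘ-homo-* ½ (1/suc n)))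
  (ℚᵘ.*≤* (ℤ.+≤+ (s≤s (subst₂ ℕ._≤_
    (sym (ℕ.+-identityʳ (suc n))) (sym (ℕ.+-identityʳ _))
    (subst (ℕ._≤ n ℕ.+ suc (n ℕ.+ 0)) (ℕ.+-comm n 1)
      (ℕ.+-monoʳ-≤ n (s≤s z≤n))))))))

½^≤1/suc : ∀ n → ½^ n ℚ.≤ 1/suc n
½^≤1/suc zero    = ℚ.≤-refl
½^≤1/suc (suc n) = ℚ.≤-trans
  (ℚ.*-monoˡ-≤-nonNeg ½ (½^≤1/suc n)) (½*1/suc n)

1/suc-small : ∀ ε → 0ℚ ℚ.< ε → ∃ λ k → ∀ n → k ℕ.≤ n → 1/suc n ℚ.≤ ε
1/suc-small (mkℚ (+ zero)     _ _) (*<* (ℤ.+<+ ()))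
1/suc-small (mkℚ (ℤ.-[1+ _ ]) _ _) (*<* ())
1/suc-small (mkℚ (+[1+ a ])   d _) _ = d , λ n d≤n →
  *≤* (ℤ.+≤+ (ℕ.*-mono-≤ (s≤s (z≤n {a})) (s≤s d≤n)))

½^-small : ∀ ε → 0ℚ ℚ.< ε → ∃ λ k → ∀ n → k ℕ.≤ n → ½^ n ℚ.≤ ε
½^-small ε 0<ε =
  let k , f = 1/suc-small ε 0<ε
  in k , λ n k≤n → ℚ.≤-trans (½^≤1/suc n) (f n k≤n)

½^≤1 : ∀ n → ½^ n ℚ.≤ 1ℚ
½^≤1 zero    = ℚ.≤-refl
½^≤1 (suc n) = ℚ.≤-trans (ℚ.*-monoˡ-≤-nonNeg ½ (½^≤1 n)) (from-yes (½ ℚ.* 1ℚ ℚ.≤? 1ℚ))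

√2-seq>0 : ∀ n → 0ℚ ℚ.< √2-seq n
√2-seq>0 zero    = ℚ.positive⁻¹ 1ℚ
√2-seq>0 (suc n) = if-elim (0ℚ ℚ.<_) (y ℚ.* y ℚ.≤? 2ℚ)
  (λ _ → ℚ.+-mono-< (√2-seq>0 n) (½^>0 (suc n))) (λ _ → √2-seq>0 n)
  where y = √2-seq n ℚ.+ ½^ suc n

√2-seq²≤2 : ∀ n → √2-seq n ℚ.* √2-seq n ℚ.≤ 2ℚ
√2-seq²≤2 zero    = from-yes (1ℚ ℚ.* 1ℚ ℚ.≤? 2ℚ)
√2-seq²≤2 (suc n) = if-elim (λ z → z ℚ.* z ℚ.≤ 2ℚ) (y ℚ.* y ℚ.≤? 2ℚ)
  (λ y²≤2 → y²≤2) (λ _ → √2-seq²≤2 n)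
  where y = √2-seq n ℚ.+ ½^ suc n

2<[√2-seq+½^]² : ∀ n → 2ℚ ℚ.< (√2-seq n ℚ.+ ½^ n) ℚ.* (√2-seq n ℚ.+ ½^ n)
2<[√2-seq+½^]² zero    = from-yes (2ℚ ℚ.<? (1ℚ ℚ.+ 1ℚ) ℚ.* (1ℚ ℚ.+ 1ℚ))
2<[√2-seq+½^]² (suc n) = if-elim
  (λ z → 2ℚ ℚ.< (z ℚ.+ ½^ suc n) ℚ.* (z ℚ.+ ½^ suc n)) (y ℚ.* y ℚ.≤? 2ℚ)
  (λ _ → subst (λ z → 2ℚ ℚ.< z ℚ.* z) (double (√2-seq n) (½^ n)) (2<[√2-seq+½^]² n))
  (λ y²≰2 → ℚ.≰⇒> y²≰2)
  where
  y = √2-seq n ℚ.+ ½^ suc n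
  double : ∀ x h → x ℚ.+ h ≡ (x ℚ.+ ½ ℚ.* h) ℚ.+ ½ ℚ.* h
  double x h = trans (cong (x ℚ.+_) (sym (½+½ h))) (sym (ℚ.+-assoc x (½ ℚ.* h) (½ ℚ.* h)))

√2-seq≤ : ∀ m n → √2-seq m ℚ.≤ √2-seq n ℚ.+ ½^ n
√2-seq≤ m n = ℚ.≮⇒≥ λ z<x → ℚ.<-irrefl refl (ℚ.<-≤-trans (2<[√2-seq+½^]² n)
  (ℚ.≤-trans (*-mono-≤ (ℚ.<⇒≤ (√2-seq>0 m))
      (ℚ.<⇒≤ (ℚ.+-mono-< (√2-seq>0 n) (½^>0 n))) (ℚ.<⇒≤ z<x) (ℚ.<⇒≤ z<x))
    (√2-seq²≤2 m)))

√2-cauchy : IsCauchy √2-seq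
√2-cauchy = oneSided λ ε 0<ε →
  let k , f = ½^-small ε 0<ε
  in k , λ m n _ k≤n → ℚ.≤-trans (√2-seq≤ m n) (ℚ.+-monoʳ-≤ (√2-seq n) (f n k≤n))

√2 : ℝ
√2 = mkℝ √2-seq √2-cauchy

√2*√2≃2 : √2 * √2 ≃ 2ℝ
√2*√2≃2 ε 0<ε =
  let δ , 0<δ , 5δ = shrink 0<5 0<ε
      k , f = ½^-small δ 0<δ
  in k , λ n k≤n → ∣-∣≤-intro (√2-seq n ℚ.* √2-seq n) 2ℚ
    (ℚ.≤-trans (√2-seq²≤2 n) (ℚ.+-monoʳ-≤ 2ℚ (ℚ.<⇒≤ 0<ε)))
    (close n (f n k≤n) 5δ)
  where
  5ℚ : ℚ
  5ℚ = + 5 ℚ./ 1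
  0<5 : 0ℚ ℚ.< 5ℚ
  0<5 = ℚ.positive⁻¹ 5ℚ
  open ℚ.≤-Reasoning
  expand : ∀ x h → (x ℚ.+ h) ℚ.* (x ℚ.+ h) ≡ x ℚ.* x ℚ.+ ((x ℚ.+ x) ℚ.+ h) ℚ.* h
  expand = solve 2 (λ x h → (x :+ h) :* (x :+ h) := x :* x :+ ((x :+ x) :+ h) :* h) refl
    where open +-*-Solver
  close : ∀ n {δ} → ½^ n ℚ.≤ δ → 5ℚ ℚ.* δ ≡ ½ ℚ.* ε →
          2ℚ ℚ.≤ √2-seq n ℚ.* √2-seq n ℚ.+ ε
  close n {δ} h≤δ 5δ = begin
    2ℚ                                  <⟨ 2<[√2-seq+½^]² n ⟩
    (x ℚ.+ h) ℚ.* (x ℚ.+ h)             ≡⟨ expand x h ⟩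
    x ℚ.* x ℚ.+ ((x ℚ.+ x) ℚ.+ h) ℚ.* h
      ≤⟨ ℚ.+-monoʳ-≤ (x ℚ.* x) (*-mono-≤ (ℚ.<⇒≤ 0<5) (ℚ.<⇒≤ (½^>0 n))
           (ℚ.+-mono-≤ (ℚ.+-mono-≤ x≤2 x≤2) (½^≤1 n)) h≤δ) ⟩
    x ℚ.* x ℚ.+ 5ℚ ℚ.* δ                ≡⟨ cong (x ℚ.* x ℚ.+_) 5δ ⟩
    x ℚ.* x ℚ.+ ½ ℚ.* ε                 ≤⟨ ℚ.+-monoʳ-≤ (x ℚ.* x) ½ε≤ε ⟩
    x ℚ.* x ℚ.+ ε                       ∎
    where
    x = √2-seq n
    h = ½^ n
    x≤2 : x ℚ.≤ 2ℚ
    x≤2 = √2-seq≤ n 0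
    ½ε≤ε : ½ ℚ.* ε ℚ.≤ ε
    ½ε≤ε = subst (½ ℚ.* ε ℚ.≤_) (ℚ.*-identityˡ ε)
      (ℚ.*-monoʳ-≤-nonNeg ε {{ℚ.nonNegative (ℚ.<⇒≤ 0<ε)}} (from-yes (½ ℚ.≤? 1ℚ)))

open CommutativeRing ℝ-commutativeRing using (+-rawMonoid; *-rawMonoid)
open RawMonoid +-rawMonoid public using (sum)
open RawMonoid *-rawMonoid public renaming (sum to product) using ()

-- ∑ P? f is the sum of f i over those i with P i.
∑ : ∀ {n} {P : Pred (Fin n) 0ℓ} → Decidable P → (Fin n → ℝ) → ℝ
∑ P? f = sum λ i → if does (P? i) then f i else 0ℝ

∑⊆ : ∀ n → (Subset n → ℝ) → ℝ
∑⊆ zero    f = f []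
∑⊆ (suc n) f = ∑⊆ n (f ∘ (inside ∷_)) + ∑⊆ n (f ∘ (outside ∷_))

-- The probability of drawing A when each i joins A independently with probability q.
Pr : ∀ {n} → ℝ → Subset n → ℝ
Pr q A = product λ i → if does (i ∈? A) then q else 1ℝ - q

-- w i i is the weight of buyer i alone; edges join distinct buyers only.
record Network (n : ℕ) : Set₁ where
  field
    w        : Fin n → Fin n → ℝ
    w-sym    : ∀ i j → w i j ≃ w j i
    w-nonNeg : ∀ i j → 0ℝ ≤ w i j
    Edge     : Rel (Fin n) 0ℓ
    edge⇔0<w : ∀ i j → Edge i j ⇔ (i ≢ j × 0ℝ < w i j)

record Strategy (n : ℕ) : Set where
  field
    π   : Permutation′ n
    p   : Fin n → ℝ
    ½≤p : ∀ i → fromℚ ½ ≤ p i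
    p≤1 : ∀ i → p i ≤ 1ℝ

  position : Fin n → Fin n
  position i = π ⟨$⟩ʳ i

-- Constructively, a maximum over a compact set such as the price vectors need
-- not be attained, so a bound on a maximum M should come with the same bound
-- on every value of f.
IsMaximum : ∀ {A : Set} → (A → ℝ) → ℝ → Set
IsMaximum f M = (∀ a → f a ≤ M) × ∃ λ a → f a ≃ M

module _ {n : ℕ} (G : Network n) where
  open Network G

  N : ℝ
  N = sum λ i → w i i

  W : ℝ
  W = sum λ i → ∑ (λ j → i Fin.<? j) λ j → w i j

  revenue : Strategy n → ℝ
  revenue s = sum λ i → p i * (1ℝ - p i) *
    (w i i + ∑ (λ j → position j Fin.<? position i) λ j → p j * w j i)
    where open Strategy s

  revenueIE : Subset n → ℝ → ℝ
  revenueIE A p = p * (1ℝ - p) * ∑ (λ i → ¬? (i ∈? A)) λ i →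
    w i i
    + ∑ (λ j → j ∈? A) (λ j → w j i)
    + ∑ (λ j → ¬? (j ∈? A) ×-dec ¬? (j Fin.≟ i)) (λ j → p * w j i * fromℚ ½)

  expectedRevenueIE : ℝ → ℝ → ℝ
  expectedRevenueIE q p = ∑⊆ n λ A → Pr q A * revenueIE A p

{-# OPTIONS --safe #-}

-- On each edge and each buyer the factor p (1 - p) is at most 1/4, and an edge is paid for by only one
-- of its endpoints, so every strategy earns at most (N + W) / 4.  By independence IE(q, p) earns
-- p (1 - p) (1 - q) (N + (2 q + (1 - q) p) W) in expectation.  For p = 2 - √2 and N = λ W its excess
-- over α (N + W) / 4 is a nonnegative multiple of (q - t)² + 2 t (q - a), where t = 1 - √2 / 2 and
-- q = a ⊔ 0; this uses √2² = 2 and q² = q a, and no case distinction on the sign of a.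
module Submission where

open import Algebra.Bundles using (CommutativeRing)
import Algebra.Properties.Monoid.Sum as Product
import Algebra.Properties.Semiring.Sum as Sum
import Algebra.Solver.Ring as RingSolver
open import Algebra.Solver.Ring.AlmostCommutativeRing
  using (fromCommutativeRing; _-Raw-AlmostCommutative⟶_)
open import Algebra.Structures using (IsCommutativeRing)
open import Data.Bool.Base using (Bool; true; false; not; _∧_; if_then_else_)
open import Data.Fin.Base as Fin using (Fin; zero; suc)
open import Data.Fin.Permutation using (inverseˡ; _⟨$⟩ˡ_)
import Data.Fin.Properties as Fin
open import Data.Fin.Subset using (Subset; inside; outside)
open import Data.Fin.Subset.Properties using (_∈?_)
open import Data.Integer.Base using (+_)
import Data.Maybe.Base as Maybe
open import Data.Nat.Base as ℕ using (zero; suc)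
open import Data.Product using (_×_; _,_)
open import Data.Rational.Base as ℚ using (ℚ; 0ℚ; 1ℚ; ½; _/_)
import Data.Rational.Properties as ℚ
open import Data.Rational.Solver using (module +-*-Solver)
open import Data.Sum.Base using (inj₁; inj₂)
open import Data.Vec.Base using ([]; _∷_)
open import Function.Base using (_∘_)
open import Function.Definitions using (Injective)
open import Level using (0ℓ)
open import Relation.Binary.Core using (Rel)
open import Relation.Binary.Definitions using (Trichotomous; tri<; tri≈; tri>)
open import Relation.Binary.PropositionalEquality as ≡ using (_≡_; _≢_)
open import Relation.Nullary using (Dec; yes; no; does; ¬?; _×-dec_)
open import Relation.Nullary.Decidable using (dec⇒maybe; dec-true; dec-false)
open import Relation.Nullary.Negation using (contradiction)
open import Relation.Unary using (Pred; Decidable)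

-- The argument is carried out over an abstract ordered ℚ-algebra, with the definitions of Defs repeated
-- there: on ℝ itself _≃_ and the operations unfold, which defeats unification and lets conversion
-- checking normalise Cauchy proofs.  Everything is part of the record so that, at ℝ, the terms below
-- match syntactically.
record OrderedAlgebra : Set₁ where
  infix  8 -_
  infixl 7 _*_
  infixl 6 _+_
  infix  4 _≈_ _≤_
  field
    Carrier : Set
    _≈_ _≤_ : Rel Carrier 0ℓ
    _+_ _*_ : Carrier → Carrier → Carrier
    -_      : Carrier → Carrier
    ι       : ℚ → Carrier
    isCommutativeRing : IsCommutativeRing _≈_ _+_ _*_ -_ (ι 0ℚ) (ι 1ℚ)
    ι-+     : ∀ x y → ι (x ℚ.+ y) ≈ ι x + ι y
    ι-*     : ∀ x y → ι (x ℚ.* y) ≈ ι x * ι y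
    ι-neg   : ∀ x → ι (ℚ.- x) ≈ - ι x
    ≤-reflexive : ∀ {x y} → x ≈ y → x ≤ y
    ≤-trans     : ∀ {x y z} → x ≤ y → y ≤ z → x ≤ z
    +-mono-≤    : ∀ {x y u v} → x ≤ y → u ≤ v → x + u ≤ y + v
    *-nonNeg    : ∀ {x y} → ι 0ℚ ≤ x → ι 0ℚ ≤ y → ι 0ℚ ≤ x * y
    sq-nonNeg   : ∀ x → ι 0ℚ ≤ x * x

  -- Ring identities and order in an ordered ℚ-algebra.

  commutativeRing : CommutativeRing 0ℓ 0ℓ
  commutativeRing = record { isCommutativeRing = isCommutativeRing }

  open CommutativeRing commutativeRing hiding (Carrier; _≈_; _+_; _*_; -_; isCommutativeRing; zero)
  open import Relation.Binary.Reasoning.Setoid setoid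
  open Sum semiring
  open Product *-monoid using () renaming (sum to product)

  -- Lets the ring solver compute with rational coefficients, so that identities containing ½ and ¼
  -- are settled by normalisation.
  ι-homomorphism : ℚ.+-*-rawRing -Raw-AlmostCommutative⟶ fromCommutativeRing commutativeRing
  ι-homomorphism = record
    { ⟦_⟧ = ι ; +-homo = ι-+ ; *-homo = ι-* ; -‿homo = ι-neg ; 0-homo = refl ; 1-homo = refl }

  open RingSolver ℚ.+-*-rawRing (fromCommutativeRing commutativeRing) ι-homomorphism
    (λ x y → Maybe.map (reflexive ∘ ≡.cong ι) (dec⇒maybe (x ℚ.≟ y)))

  2ι ¼ι : Carrier
  2ι = ι (+ 2 / 1)
  ¼ι = ι (+ 1 / 4)

  c2 c¼ : ∀ {n} → Polynomial n
  c2 = con (+ 2 / 1)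
  c¼ = con (+ 1 / 4)

  ≤-respʳ : ∀ {x y z} → y ≈ z → x ≤ y → x ≤ z
  ≤-respʳ y≈z x≤y = ≤-trans x≤y (≤-reflexive y≈z)

  ≤-respˡ : ∀ {x y z} → x ≈ y → x ≤ z → y ≤ z
  ≤-respˡ x≈y x≤z = ≤-trans (≤-reflexive (sym x≈y)) x≤z

  +-nonNeg : ∀ {x y} → 0# ≤ x → 0# ≤ y → 0# ≤ x + y
  +-nonNeg 0≤x 0≤y = ≤-respˡ (+-identityˡ 0#) (+-mono-≤ 0≤x 0≤y)

  x≤y⇒0≤y-x : ∀ {x y} → x ≤ y → 0# ≤ y - x
  x≤y⇒0≤y-x {x} x≤y = ≤-respˡ (-‿inverseʳ x) (+-mono-≤ x≤y (≤-reflexive refl))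

  -- The polynomial inequalities below all go through this form: the gap `z` is written as an
  -- evidently nonnegative expression and the solver checks the identity.
  0≤z∧y≈x+z⇒x≤y : ∀ {x y z} → 0# ≤ z → y ≈ x + z → x ≤ y
  0≤z∧y≈x+z⇒x≤y {x} 0≤z y≈x+z =
    ≤-respʳ (sym y≈x+z) (≤-respˡ (+-identityʳ x) (+-mono-≤ (≤-reflexive refl) 0≤z))

  *-mono-≤ : ∀ {x y u v} → 0# ≤ y → 0# ≤ u → x ≤ y → u ≤ v → x * u ≤ y * v
  *-mono-≤ {x} {y} {u} {v} 0≤y 0≤u x≤y u≤v = 0≤z∧y≈x+z⇒x≤y
    (+-nonNeg (*-nonNeg 0≤y (x≤y⇒0≤y-x u≤v)) (*-nonNeg (x≤y⇒0≤y-x x≤y) 0≤u))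
    (solve 4 (λ x y u v → y :* v := x :* u :+ (y :* (v :- u) :+ (y :- x) :* u)) refl x y u v)

  -- The signs of the constants come from squares: 1 = 1 · 1 and ¼ = ½ · ½, and then ½ = ¼ + ¼.
  0≤1 : 0# ≤ 1#
  0≤1 = ≤-respʳ (*-identityˡ 1#) (sq-nonNeg 1#)

  0≤¼ : 0# ≤ ¼ι
  0≤¼ = ≤-respʳ (sym (ι-* ½ ½)) (sq-nonNeg (ι ½))

  0≤½ : 0# ≤ ι ½
  0≤½ = ≤-respʳ (sym (ι-+ _ _)) (+-nonNeg 0≤¼ 0≤¼)

  -- Serves to identify two sums over unordered pairs of buyers, each of which doubles to the same
  -- sum over ordered pairs.
  double-injective : ∀ {x y} → x + x ≈ y + y → x ≈ y
  double-injective {x} {y} 2x≈2y = begin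
    x             ≈⟨ halve x ⟩
    ι ½ * (x + x)  ≈⟨ *-congˡ 2x≈2y ⟩
    ι ½ * (y + y)  ≈⟨ halve y ⟨
    y             ∎
    where halve = solve 1 (λ x → x := con ½ :* (x :+ x)) refl

  x[1-x]≤¼ : ∀ x → x * (1# - x) ≤ ¼ι
  x[1-x]≤¼ x = 0≤z∧y≈x+z⇒x≤y (sq-nonNeg (ι ½ - x))
    (solve 1 (λ x → c¼ := x :* (con 1ℚ :- x) :+ (con ½ :- x) :* (con ½ :- x)) refl x)

  -- Finite sums, guarded sums and sums over pairs.

  sum-mono-≤ : ∀ {n} {f g : Fin n → Carrier} → (∀ i → f i ≤ g i) → sum f ≤ sum g
  sum-mono-≤ {zero}  f≤g = ≤-reflexive refl
  sum-mono-≤ {suc n} f≤g = +-mono-≤ (f≤g zero) (sum-mono-≤ (f≤g ∘ suc))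

  ∑ : ∀ {n} {P : Pred (Fin n) 0ℓ} → Decidable P → (Fin n → Carrier) → Carrier
  ∑ P? f = sum λ i → if does (P? i) then f i else 0#

  ∑-mono-≤ : ∀ {n} {P : Pred (Fin n) 0ℓ} (P? : Decidable P) {f g : Fin n → Carrier} →
             (∀ i → f i ≤ g i) → ∑ P? f ≤ ∑ P? g
  ∑-mono-≤ P? f≤g = sum-mono-≤ λ i → if-mono (does (P? i)) (f≤g i)
    where
    if-mono : ∀ b {x y} → x ≤ y → (if b then x else 0#) ≤ (if b then y else 0#)
    if-mono true  x≤y = x≤y
    if-mono false _   = ≤-reflexive refl

  ∑-nonNeg : ∀ {n} {P : Pred (Fin n) 0ℓ} (P? : Decidable P) {f : Fin n → Carrier} →
             (∀ i → 0# ≤ f i) → 0# ≤ ∑ P? f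
  ∑-nonNeg {n} P? 0≤f = ≤-respˡ
    (trans (sum-cong-≋ (λ i → if-zero (does (P? i)))) (sum-replicate-zero n))
    (∑-mono-≤ P? {f = λ _ → 0#} 0≤f)
    where
    if-zero : ∀ b → (if b then 0# else 0#) ≈ 0#
    if-zero true  = refl
    if-zero false = refl

  if-cong : ∀ b {x y} → x ≈ y → (if b then x else 0#) ≈ (if b then y else 0#)
  if-cong true  x≈y = x≈y
  if-cong false _   = refl

  if-*ˡ : ∀ b x {y} → (if b then x * y else 0#) ≈ x * (if b then y else 0#)
  if-*ˡ true  x = refl
  if-*ˡ false x = sym (zeroʳ x)

  *-distribˡ-∑ : ∀ {n} {P : Pred (Fin n) 0ℓ} (P? : Decidable P) x (f : Fin n → Carrier) →
                 x * ∑ P? f ≈ ∑ P? (λ i → x * f i)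
  *-distribˡ-∑ P? x f = trans (*-distribˡ-sum x (λ i → if does (P? i) then f i else 0#))
    (sum-cong-≋ λ i → sym (if-*ˡ (does (P? i)) x))

  ∑≢ : ∀ {n} → (Fin n → Fin n → Carrier) → Carrier
  ∑≢ f = sum λ i → ∑ (λ j → ¬? (j Fin.≟ i)) (f i)

  -- A strict total order contains exactly one of (i , j) and (j , i) for i ≢ j.
  ∑∑-trichotomous : ∀ {n} {_≺_ : Rel (Fin n) 0ℓ} (_≺?_ : ∀ i j → Dec (i ≺ j)) →
    Trichotomous _≡_ _≺_ → (f : Fin n → Fin n → Carrier) → (∀ i j → f i j ≈ f j i) →
    let S = sum λ i → ∑ (i ≺?_) (f i) in S + S ≈ ∑≢ f
  ∑∑-trichotomous {n} {_≺_} _≺?_ cmp f f-sym = begin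
    -- Exchanging the summations in the second copy of `S` turns its guard into `j ≺ i`, so both
    -- copies run over the same outer index.
    S + S                                                 ≈⟨ +-congˡ (∑-comm (λ i j → F (i ≺? j) i j)) ⟩
    S + sum (λ i → sum λ j → F (j ≺? i) j i)              ≈⟨ ∑-distrib-+ (λ i → sum λ j → F (i ≺? j) i j) (λ i → sum λ j → F (j ≺? i) j i) ⟨
    sum (λ i → sum (λ j → F (i ≺? j) i j) + sum λ j → F (j ≺? i) j i)
      ≈⟨ sum-cong-≋ (λ i → sym (∑-distrib-+ (λ j → F (i ≺? j) i j) (λ j → F (j ≺? i) j i))) ⟩
    sum (λ i → sum λ j → F (i ≺? j) i j + F (j ≺? i) j i) ≈⟨ sum-cong-≋ (λ i → sum-cong-≋ λ j → pair i j) ⟩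
    ∑≢ f                                                  ∎
    where
    F : ∀ {P : Set} → Dec P → Fin n → Fin n → Carrier
    F d i j = if does d then f i j else 0#
    S = sum λ i → ∑ (i ≺?_) (f i)
    -- On the diagonal both guards fail. Off it exactly one holds; when it is `j ≺ i`, the surviving
    -- term `f j i` is turned around by symmetry.
    pair : ∀ i j → F (i ≺? j) i j + F (j ≺? i) j i ≈ F (¬? (j Fin.≟ i)) i j
    pair i j with cmp i j
    ... | tri< i≺j i≢j j⊀i
      rewrite dec-true (i ≺? j) i≺j | dec-false (j ≺? i) j⊀i | dec-false (j Fin.≟ i) (i≢j ∘ ≡.sym) = +-identityʳ _
    ... | tri≈ i⊀j i≡j j⊀i
      rewrite dec-false (i ≺? j) i⊀j | dec-false (j ≺? i) j⊀i | dec-true (j Fin.≟ i) (≡.sym i≡j) = +-identityʳ _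
    ... | tri> i⊀j i≢j j≺i
      rewrite dec-false (i ≺? j) i⊀j | dec-true (j ≺? i) j≺i | dec-false (j Fin.≟ i) (i≢j ∘ ≡.sym) = trans (+-identityˡ _) (f-sym j i)

  -- Expectation over a random subset and independence of its membership bits.

  ∑⊆ : ∀ n → (Subset n → Carrier) → Carrier
  ∑⊆ zero    f = f []
  ∑⊆ (suc n) f = ∑⊆ n (f ∘ (inside ∷_)) + ∑⊆ n (f ∘ (outside ∷_))

  ∑⊆-cong : ∀ n {f g} → (∀ A → f A ≈ g A) → ∑⊆ n f ≈ ∑⊆ n g
  ∑⊆-cong zero    f≈g = f≈g []
  ∑⊆-cong (suc n) f≈g = +-cong (∑⊆-cong n (f≈g ∘ (inside ∷_))) (∑⊆-cong n (f≈g ∘ (outside ∷_)))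

  ∑⊆-+ : ∀ n f g → ∑⊆ n (λ A → f A + g A) ≈ ∑⊆ n f + ∑⊆ n g
  ∑⊆-+ zero    f g = refl
  ∑⊆-+ (suc n) f g = trans
    (+-cong (∑⊆-+ n (f ∘ (inside ∷_)) (g ∘ (inside ∷_))) (∑⊆-+ n (f ∘ (outside ∷_)) (g ∘ (outside ∷_))))
    (solve 4 (λ a b c d → (a :+ b) :+ (c :+ d) := (a :+ c) :+ (b :+ d)) refl _ _ _ _)

  ∑⊆-*ˡ : ∀ n x f → ∑⊆ n (λ A → x * f A) ≈ x * ∑⊆ n f
  ∑⊆-*ˡ zero    x f = refl
  ∑⊆-*ˡ (suc n) x f = trans
    (+-cong (∑⊆-*ˡ n x (f ∘ (inside ∷_))) (∑⊆-*ˡ n x (f ∘ (outside ∷_)))) (sym (distribˡ x _ _))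

  Pr : ∀ {n} → Carrier → Subset n → Carrier
  Pr q A = product λ i → if does (i ∈? A) then q else 1# - q

  module _ (q : Carrier) where

    𝔼 : ∀ n → (Subset n → Carrier) → Carrier
    𝔼 n f = ∑⊆ n λ A → Pr q A * f A

    𝔼-cong : ∀ {n f g} → (∀ A → f A ≈ g A) → 𝔼 n f ≈ 𝔼 n g
    𝔼-cong {n} f≈g = ∑⊆-cong n (*-congˡ ∘ f≈g)

    𝔼-+ : ∀ {n} f g → 𝔼 n (λ A → f A + g A) ≈ 𝔼 n f + 𝔼 n g
    𝔼-+ {n} f g = trans (∑⊆-cong n (λ A → distribˡ (Pr q A) (f A) (g A)))
      (∑⊆-+ n (λ A → Pr q A * f A) (λ A → Pr q A * g A))

    𝔼-*ˡ : ∀ {n} x f → 𝔼 n (λ A → x * f A) ≈ x * 𝔼 n f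
    𝔼-*ˡ {n} x f = trans
      (∑⊆-cong n (λ A → solve 3 (λ p x y → p :* (x :* y) := x :* (p :* y)) refl (Pr q A) x (f A)))
      (∑⊆-*ˡ n x (λ A → Pr q A * f A))

    -- Conditioning on the first buyer: `Pr` splits off its first factor, which is `q` or `1# - q`.
    -- The inductions on `n` below rest on this.
    𝔼-suc : ∀ {n} f → 𝔼 (suc n) f ≈ q * 𝔼 n (f ∘ (inside ∷_)) + (1# - q) * 𝔼 n (f ∘ (outside ∷_))
    𝔼-suc {n} f = +-cong (side inside q) (side outside (1# - q))
      where
      side : ∀ b x → ∑⊆ n (λ A → x * Pr q A * f (b ∷ A)) ≈ x * 𝔼 n (f ∘ (b ∷_))
      side b x = trans (∑⊆-cong n (λ A → *-assoc x (Pr q A) (f (b ∷ A))))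
        (∑⊆-*ˡ n x (λ A → Pr q A * f (b ∷ A)))

    average-const : ∀ x → q * x + (1# - q) * x ≈ x
    average-const = solve 2 (λ q x → q :* x :+ (con 1ℚ :- q) :* x := x) refl q

    𝔼-const : ∀ n x → 𝔼 n (λ _ → x) ≈ x
    𝔼-const zero    x = *-identityˡ x
    𝔼-const (suc n) x = trans (𝔼-suc {n} (λ _ → x))
      (trans (+-cong (*-congˡ (𝔼-const n x)) (*-congˡ (𝔼-const n x))) (average-const x))

    𝔼-sum : ∀ {m n} (f : Fin m → Subset n → Carrier) →
            𝔼 n (λ A → sum λ i → f i A) ≈ sum λ i → 𝔼 n (f i)
    𝔼-sum {zero}  {n} f = 𝔼-const n 0#
    𝔼-sum {suc m} f = trans (𝔼-+ (f zero) (λ A → sum λ i → f (suc i) A)) (+-congˡ (𝔼-sum (f ∘ suc)))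

    -- The expectation of `h` at a single biased coin.
    mean : (Bool → Carrier) → Carrier
    mean h = q * h true + (1# - q) * h false

    -- Coins other than that of `i` average out: those after `i` see a constant, and those before it
    -- average two equal values.
    𝔼-single : ∀ {n} (i : Fin n) h → 𝔼 n (λ A → h (does (i ∈? A))) ≈ mean h
    𝔼-single {suc n} zero    h = trans (𝔼-suc {n} (λ A → h (does (zero ∈? A))))
      (+-cong (*-congˡ (𝔼-const n (h true))) (*-congˡ (𝔼-const n (h false))))
    𝔼-single {suc n} (suc i) h = trans (𝔼-suc (λ A → h (does (suc i ∈? A))))
      (trans (+-cong (*-congˡ (𝔼-single i h)) (*-congˡ (𝔼-single i h))) (average-const (mean h)))

    -- Once the first coin is fixed, `h` is a constant factor, and the rest depends on the single
    -- coin `j`.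
    𝔼-zero-suc : ∀ {n} (j : Fin n) h k →
                 𝔼 (suc n) (λ A → h (does (zero ∈? A)) * k (does (suc j ∈? A))) ≈ mean h * mean k
    𝔼-zero-suc {n} j h k = begin
      𝔼 (suc n) (λ A → h (does (zero ∈? A)) * k (does (suc j ∈? A)))
        ≈⟨ 𝔼-suc (λ A → h (does (zero ∈? A)) * k (does (suc j ∈? A))) ⟩
      q * 𝔼 n (λ A → h true * k (does (j ∈? A))) + (1# - q) * 𝔼 n (λ A → h false * k (does (j ∈? A)))
        ≈⟨ +-cong (*-congˡ (pull (h true))) (*-congˡ (pull (h false))) ⟩
      q * (h true * mean k) + (1# - q) * (h false * mean k)
        ≈⟨ solve 4 (λ q x y m → q :* (x :* m) :+ (con 1ℚ :- q) :* (y :* m) := (q :* x :+ (con 1ℚ :- q) :* y) :* m)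
             refl q (h true) (h false) (mean k) ⟩
      mean h * mean k ∎
      where
      pull : ∀ x → 𝔼 n (λ A → x * k (does (j ∈? A))) ≈ x * mean k
      pull x = trans (𝔼-*ˡ x (λ A → k (does (j ∈? A)))) (*-congˡ (𝔼-single j k))

    -- The coins in front of both `i` and `j` average equal values and are peeled off until one of
    -- the two is the first; `𝔼-zero-suc` then applies, up to commuting the factors.
    𝔼-independent : ∀ {n} {i j : Fin n} → i ≢ j → ∀ h k →
                    𝔼 n (λ A → h (does (i ∈? A)) * k (does (j ∈? A))) ≈ mean h * mean k
    𝔼-independent {suc n} {zero}  {zero}  i≢j h k = contradiction ≡.refl i≢j
    𝔼-independent {suc n} {zero}  {suc j} i≢j h k = 𝔼-zero-suc j h k
    𝔼-independent {suc n} {suc i} {zero}  i≢j h k = begin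
      𝔼 (suc n) (λ A → h (does (suc i ∈? A)) * k (does (zero ∈? A)))
        ≈⟨ 𝔼-cong (λ A → *-comm (h (does (suc i ∈? A))) (k (does (zero ∈? A)))) ⟩
      𝔼 (suc n) (λ A → k (does (zero ∈? A)) * h (does (suc i ∈? A)))
        ≈⟨ 𝔼-zero-suc i k h ⟩
      mean k * mean h ≈⟨ *-comm (mean k) (mean h) ⟩
      mean h * mean k ∎
    𝔼-independent {suc n} {suc i} {suc j} i≢j h k =
      trans (𝔼-suc (λ A → h (does (suc i ∈? A)) * k (does (suc j ∈? A))))
        (trans (+-cong (*-congˡ ih) (*-congˡ ih)) (average-const (mean h * mean k)))
      where ih = 𝔼-independent (i≢j ∘ ≡.cong suc) h k

  -- i is charged, and j ≢ i gets the product for free or is charged, precedes i (½) and buys (p).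
  κ : Carrier → Carrier → Carrier
  κ q p = (1# - q) * (q + (1# - q) * (p * ι ½))

  -- Upper bound for arbitrary strategies and exact expectation for IE.

  module _ {n} (w : Fin n → Fin n → Carrier)
    (w-sym : ∀ i j → w i j ≈ w j i) (w-nonNeg : ∀ i j → 0# ≤ w i j) where

    N W : Carrier
    N = sum λ i → w i i
    W = sum λ i → ∑ (λ j → i Fin.<? j) (w i)

    W+W≈∑≢ : W + W ≈ ∑≢ λ i j → w j i
    W+W≈∑≢ = trans (∑∑-trichotomous Fin._<?_ Fin.<-cmp w w-sym)
      (sum-cong-≋ λ i → sum-cong-≋ λ j → if-cong (does (¬? (j Fin.≟ i))) (w-sym i j))

    revenue : (Fin n → Fin n) → (Fin n → Carrier) → Carrier
    revenue position p = sum λ i → p i * (1# - p i) *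
      (w i i + ∑ (λ j → position j Fin.<? position i) λ j → p j * w j i)

    -- After each `p i * (1# - p i)` is bounded by ¼ and each `p j` by 1, every edge remains once,
    -- at its later endpoint. `W` also counts it once, at its smaller index.
    revenue≤¼[N+W] : ∀ {position} → Injective _≡_ _≡_ position → ∀ {p} → (∀ i → ι ½ ≤ p i) → (∀ i → p i ≤ 1#) →
                     revenue position p ≤ ¼ι * (N + W)
    revenue≤¼[N+W] {position} position-inj {p} ½≤p p≤1 = ≤-respʳ total
      (sum-mono-≤ λ i → *-mono-≤ 0≤¼
        -- `*-mono-≤` asks for the sign of the bracket before its terms are enlarged.
        (+-nonNeg (w-nonNeg i i) (∑-nonNeg (earlier? i) λ j → *-nonNeg (0≤p j) (w-nonNeg j i)))
        (x[1-x]≤¼ (p i))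
        (+-mono-≤ (≤-reflexive refl) (∑-mono-≤ (earlier? i) λ j →
          ≤-respʳ (*-identityˡ (w j i)) (*-mono-≤ 0≤1 (w-nonNeg j i) (p≤1 j) (≤-reflexive refl)))))
      where
      earlier? : ∀ i j → Dec _
      earlier? i j = position j Fin.<? position i
      0≤p : ∀ i → 0# ≤ p i
      0≤p i = ≤-trans 0≤½ (½≤p i)
      S : Carrier
      S = sum λ i → ∑ (earlier? i) λ j → w j i
      -- The order is reversed, since the inner index `j` of `revenue` is the earlier buyer.
      -- Injectivity makes buyers at equal positions equal.
      cmp : Trichotomous _≡_ (λ i j → position j Fin.< position i)
      cmp i j with Fin.<-cmp (position j) (position i)
      ... | tri< a b c = tri< a (b ∘ ≡.cong position ∘ ≡.sym) c
      ... | tri≈ a b c = tri≈ a (position-inj (≡.sym b)) c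
      ... | tri> a b c = tri> a (b ∘ ≡.cong position ∘ ≡.sym) c
      total : sum (λ i → ¼ι * (w i i + ∑ (earlier? i) λ j → w j i)) ≈ ¼ι * (N + W)
      total = begin
        sum (λ i → ¼ι * (w i i + ∑ (earlier? i) λ j → w j i))
          ≈⟨ *-distribˡ-sum ¼ι (λ i → w i i + ∑ (earlier? i) λ j → w j i) ⟨
        ¼ι * sum (λ i → w i i + ∑ (earlier? i) λ j → w j i)
          ≈⟨ *-congˡ (∑-distrib-+ (λ i → w i i) (λ i → ∑ (earlier? i) λ j → w j i)) ⟩
        ¼ι * (N + S)
          ≈⟨ *-congˡ (+-congˡ (double-injective
               (trans (∑∑-trichotomous earlier? cmp (λ i j → w j i) (λ i j → w-sym j i)) (sym W+W≈∑≢)))) ⟩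
        ¼ι * (N + W) ∎

    -- The factor p (1 - p) is kept as an opaque `c`, because the expectation only has to pull it
    -- out.
    revenueIE : Carrier → Carrier → Subset n → Carrier
    revenueIE c p A = c * ∑ (λ i → ¬? (i ∈? A)) λ i →
      w i i
      + ∑ (λ j → j ∈? A) (λ j → w j i)
      + ∑ (λ j → ¬? (j ∈? A) ×-dec ¬? (j Fin.≟ i)) (λ j → p * w j i * ι ½)

    module _ (q c p : Carrier) where

      out : Bool → Carrier
      out b = if not b then 1# else 0#

      -- Both ways in which `j` can add to the value for `i`, as a function of the membership bit of
      -- `j` alone; this is the shape that `𝔼-independent` takes. The second guard is what the
      -- decision in `revenueIE` computes to.
      fromBuyer : Fin n → Fin n → Bool → Carrier
      fromBuyer i j b =
        (if b then w j i else 0#) + (if not b ∧ not (does (j Fin.≟ i)) then p * w j i * ι ½ else 0#)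

      -- For `j` equal to `i` the product is 0 for either bit: `out` vanishes inside the set, and
      -- both summands vanish outside it. Otherwise the two bits are independent, and `κ q p`
      -- collects the two means.
      expectedFromBuyer : ∀ i j →
        𝔼 q n (λ A → out (does (i ∈? A)) * fromBuyer i j (does (j ∈? A)))
        ≈ (if does (¬? (j Fin.≟ i)) then κ q p * w j i else 0#)
      expectedFromBuyer i j with j Fin.≟ i
      ... | yes ≡.refl = trans (𝔼-cong q (λ A → excluded (does (j ∈? A)))) (𝔼-const q n 0#)
        where
        excluded : ∀ b → out b * ((if b then w j j else 0#) + (if not b ∧ false then p * w j j * ι ½ else 0#)) ≈ 0#
        excluded true  = zeroˡ _
        excluded false = trans (*-identityˡ _) (+-identityˡ _)
      ... | no j≢i = trans
        (𝔼-independent q (j≢i ∘ ≡.sym) out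
          (λ b → (if b then w j i else 0#) + (if not b ∧ true then p * w j i * ι ½ else 0#)))
        (solve 3 (λ q p x →
          (q :* con 0ℚ :+ (con 1ℚ :- q) :* con 1ℚ)
            :* (q :* (x :+ con 0ℚ) :+ (con 1ℚ :- q) :* (con 0ℚ :+ p :* x :* con ½))
          := (con 1ℚ :- q) :* (q :+ (con 1ℚ :- q) :* (p :* con ½)) :* x) refl q p (w j i))

      -- Linearity reduces the claim to single buyers and ordered pairs. Each edge is met from both
      -- endpoints, whence `W + W`.
      𝔼-revenueIE : 𝔼 q n (revenueIE c p) ≈ c * ((1# - q) * N + κ q p * (W + W))
      𝔼-revenueIE = begin
        𝔼 q n (revenueIE c p)
          ≈⟨ 𝔼-*ˡ q c (λ A → sum λ i → if not (does (i ∈? A)) then income A i else 0#) ⟩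
        c * 𝔼 q n (λ A → sum λ i → if not (does (i ∈? A)) then income A i else 0#)
          ≈⟨ *-congˡ (𝔼-sum q (λ i A → if not (does (i ∈? A)) then income A i else 0#)) ⟩
        c * sum (λ i → 𝔼 q n λ A → if not (does (i ∈? A)) then income A i else 0#)
          ≈⟨ *-congˡ (sum-cong-≋ expectedIncome) ⟩
        c * sum (λ i → (1# - q) * w i i + κ q p * ∑ (λ j → ¬? (j Fin.≟ i)) λ j → w j i)
          ≈⟨ *-congˡ (∑-distrib-+ (λ i → (1# - q) * w i i) (λ i → κ q p * ∑ (λ j → ¬? (j Fin.≟ i)) λ j → w j i)) ⟩
        c * (sum (λ i → (1# - q) * w i i) + sum (λ i → κ q p * ∑ (λ j → ¬? (j Fin.≟ i)) λ j → w j i))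
          ≈⟨ *-congˡ (+-cong (*-distribˡ-sum (1# - q) (λ i → w i i))
               (*-distribˡ-sum (κ q p) (λ i → ∑ (λ j → ¬? (j Fin.≟ i)) λ j → w j i))) ⟨
        c * ((1# - q) * N + κ q p * ∑≢ (λ i j → w j i))
          ≈⟨ *-congˡ (+-congˡ (*-congˡ W+W≈∑≢)) ⟨
        c * ((1# - q) * N + κ q p * (W + W)) ∎
        where
        income : Subset n → Fin n → Carrier
        income A i = w i i
          + ∑ (λ j → j ∈? A) (λ j → w j i)
          + ∑ (λ j → ¬? (j ∈? A) ×-dec ¬? (j Fin.≟ i)) (λ j → p * w j i * ι ½)

        -- Merges the sums over the free and the charged buyers into one sum over `j`, each term of
        -- which depends on the bits of `i` and `j` only.
        split : ∀ i A → (if not (does (i ∈? A)) then income A i else 0#)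
          ≈ out (does (i ∈? A)) * w i i + sum λ j → out (does (i ∈? A)) * fromBuyer i j (does (j ∈? A))
        split i A = begin
          (if not b then income A i else 0#)
            ≈⟨ if-out b (income A i) ⟩
          out b * (w i i + fromA + fromRest)
            ≈⟨ solve 4 (λ x y z u → x :* (y :+ z :+ u) := x :* y :+ x :* (z :+ u)) refl (out b) (w i i) fromA fromRest ⟩
          out b * w i i + out b * (fromA + fromRest)
            ≈⟨ +-congˡ (*-congˡ (∑-distrib-+ (λ j → if does (j ∈? A) then w j i else 0#)
                 (λ j → if not (does (j ∈? A)) ∧ not (does (j Fin.≟ i)) then p * w j i * ι ½ else 0#))) ⟨
          out b * w i i + out b * sum (λ j → fromBuyer i j (does (j ∈? A)))
            ≈⟨ +-congˡ (*-distribˡ-sum (out b) (λ j → fromBuyer i j (does (j ∈? A)))) ⟩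
          out b * w i i + sum (λ j → out b * fromBuyer i j (does (j ∈? A))) ∎
          where
          b = does (i ∈? A)
          fromA = ∑ (λ j → j ∈? A) (λ j → w j i)
          fromRest = ∑ (λ j → ¬? (j ∈? A) ×-dec ¬? (j Fin.≟ i)) (λ j → p * w j i * ι ½)
          if-out : ∀ b x → (if not b then x else 0#) ≈ out b * x
          if-out true  x = sym (zeroˡ x)
          if-out false x = sym (*-identityˡ x)

        expectedIncome : ∀ i → 𝔼 q n (λ A → if not (does (i ∈? A)) then income A i else 0#)
          ≈ (1# - q) * w i i + κ q p * ∑ (λ j → ¬? (j Fin.≟ i)) λ j → w j i
        expectedIncome i = begin
          𝔼 q n (λ A → if not (does (i ∈? A)) then income A i else 0#)
            ≈⟨ 𝔼-cong q (split i) ⟩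
          𝔼 q n (λ A → out (does (i ∈? A)) * w i i + sum λ j → out (does (i ∈? A)) * fromBuyer i j (does (j ∈? A)))
            ≈⟨ 𝔼-+ q (λ A → out (does (i ∈? A)) * w i i) (λ A → sum λ j → out (does (i ∈? A)) * fromBuyer i j (does (j ∈? A))) ⟩
          𝔼 q n (λ A → out (does (i ∈? A)) * w i i) + 𝔼 q n (λ A → sum λ j → out (does (i ∈? A)) * fromBuyer i j (does (j ∈? A)))
            ≈⟨ +-cong
                 (trans (𝔼-single q i (λ b → out b * w i i))
                   (solve 2 (λ q x → q :* (con 0ℚ :* x) :+ (con 1ℚ :- q) :* (con 1ℚ :* x) := (con 1ℚ :- q) :* x) refl q (w i i)))
                 (trans (𝔼-sum q (λ j A → out (does (i ∈? A)) * fromBuyer i j (does (j ∈? A))))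
                   (sum-cong-≋ (expectedFromBuyer i))) ⟩
          (1# - q) * w i i + ∑ (λ j → ¬? (j Fin.≟ i)) (λ j → κ q p * w j i)
            ≈⟨ +-congˡ (*-distribˡ-∑ (λ j → ¬? (j Fin.≟ i)) (κ q p) (λ j → w j i)) ⟨
          (1# - q) * w i i + κ q p * ∑ (λ j → ¬? (j Fin.≟ i)) (λ j → w j i) ∎

  -- Comparison of the expected revenue with the upper bound.

  -- a maximises the expected revenue over all real q; u and 2 s are the cofactors of s² - 2 and
  -- q² - q a in the identity for the excess.
  approximation : ∀ {s ƛ a q N W α r e} →
    s * s ≈ 2ι → 1# ≤ s → s ≤ 2ι → 0# ≤ W → N ≈ ƛ * W →
    a ≈ 1# - s * (2ι + ƛ) * ¼ι → a ≤ q → q * q ≈ q * a →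
    α ≈ 2ι * s * (2ι - s) * (s - 1#) → r ≤ ¼ι * (N + W) →
    e ≈ (2ι - s) * (1# - (2ι - s)) * ((1# - q) * N + κ q (2ι - s) * (W + W)) →
    α * r ≤ e
  approximation {s} {ƛ} {a} {q} {N} {W} {α} {r} {e} s²≈2 1≤s s≤2 0≤W N≈ƛW a≈b a≤q q²≈qa α≈ r≤ e≈ =
    ≤-trans (≤-respˡ (*-congʳ (sym α≈)) (*-mono-≤′ 0≤α r≤)) (0≤z∧y≈x+z⇒x≤y 0≤PWD gap)
    where
    -- `P` is p (1 - p) at p = 2 - s, `b` and `α′` are `a` and `α` spelled out, and `P * W * D` is
    -- the excess over `α′ * (¼ι * (N + W))`.
    P b t D u α′ : Carrier
    P = (2ι - s) * (s - 1#)
    b = 1# - s * (2ι + ƛ) * ¼ι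
    t = ι ½ * (2ι - s)
    -- Expands to s (q² + t² - 2 t b). The form chosen shows its sign: a square, plus a product that
    -- is nonnegative since t ≥ 0 and b ≤ q.
    D = s * ((q - t) * (q - t) + 2ι * t * (q - b))
    u = q * (2ι + ƛ) * ι ½ + s * (1# + ƛ) * ¼ι - 1# - ƛ * ι ½
    α′ = 2ι * s * (2ι - s) * (s - 1#)
    -- Asks for the sign of the common factor only; `*-mono-≤` would also ask for that of `r`, about
    -- which nothing is assumed.
    *-mono-≤′ : ∀ {x y z} → 0# ≤ x → y ≤ z → x * y ≤ x * z
    *-mono-≤′ {x} {y} {z} 0≤x y≤z = 0≤z∧y≈x+z⇒x≤y (*-nonNeg 0≤x (x≤y⇒0≤y-x y≤z))
      (solve 3 (λ x y z → x :* z := x :* y :+ x :* (z :- y)) refl x y z)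
    0≤2 : 0# ≤ 2ι
    0≤2 = ≤-respʳ s²≈2 (sq-nonNeg s)
    0≤s = ≤-trans 0≤1 1≤s
    0≤2-s = x≤y⇒0≤y-x s≤2
    0≤s-1 = x≤y⇒0≤y-x 1≤s
    0≤α : 0# ≤ α′
    0≤α = *-nonNeg (*-nonNeg (*-nonNeg 0≤2 0≤s) 0≤2-s) 0≤s-1
    0≤PWD : 0# ≤ P * W * D
    0≤PWD = *-nonNeg (*-nonNeg (*-nonNeg 0≤2-s 0≤s-1) 0≤W)
      (*-nonNeg 0≤s (+-nonNeg (sq-nonNeg (q - t))
        (*-nonNeg (*-nonNeg 0≤2 (*-nonNeg 0≤½ 0≤2-s)) (x≤y⇒0≤y-x (≤-respˡ a≈b a≤q)))))
    x≈y⇒x-y≈0 : ∀ {x y} → x ≈ y → x - y ≈ 0#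
    x≈y⇒x-y≈0 {x} {y} x≈y = trans (+-congʳ x≈y) (-‿inverseʳ y)
    vanish : P * W * (u * (s * s - 2ι) - 2ι * s * (q * q - q * b)) ≈ 0#
    vanish = begin
      P * W * (u * (s * s - 2ι) - 2ι * s * (q * q - q * b))
        ≈⟨ *-congˡ (+-cong (*-congˡ (x≈y⇒x-y≈0 s²≈2)) (-‿cong (*-congˡ (x≈y⇒x-y≈0 (trans q²≈qa (*-congˡ a≈b)))))) ⟩
      P * W * (u * 0# - 2ι * s * 0#)
        ≈⟨ solve 3 (λ x y z → x :* (y :* con 0ℚ :- z :* con 0ℚ) := con 0ℚ) refl (P * W) u (2ι * s) ⟩
      0# ∎
    gap : e ≈ α′ * (¼ι * (N + W)) + P * W * D
    gap = begin
      e
        ≈⟨ e≈ ⟩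
      (2ι - s) * (1# - (2ι - s)) * ((1# - q) * N + κ q (2ι - s) * (W + W))
        ≈⟨ *-congˡ (+-congʳ (*-congˡ N≈ƛW)) ⟩
      (2ι - s) * (1# - (2ι - s)) * ((1# - q) * (ƛ * W) + κ q (2ι - s) * (W + W))
        -- An identity in free variables: the relations s² = 2 and q² = q b enter as explicit
        -- multiples of their differences, which `vanish` then removes.
        ≈⟨ solve 4 (λ s ƛ q W →
             let P = (c2 :- s) :* (s :- con 1ℚ)
                 b = con 1ℚ :- s :* (c2 :+ ƛ) :* c¼
                 t = con ½ :* (c2 :- s)
                 D = s :* ((q :- t) :* (q :- t) :+ c2 :* t :* (q :- b))
                 u = q :* (c2 :+ ƛ) :* con ½ :+ s :* (con 1ℚ :+ ƛ) :* c¼ :- con 1ℚ :- ƛ :* con ½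
             in (c2 :- s) :* (con 1ℚ :- (c2 :- s)) :*
                  ((con 1ℚ :- q) :* (ƛ :* W)
                    :+ (con 1ℚ :- q) :* (q :+ (con 1ℚ :- q) :* ((c2 :- s) :* con ½)) :* (W :+ W))
                := c2 :* s :* (c2 :- s) :* (s :- con 1ℚ) :* (c¼ :* (ƛ :* W :+ W))
                   :+ (P :* W :* D :+ P :* W :* (u :* (s :* s :- c2) :- c2 :* s :* (q :* q :- q :* b))))
             refl s ƛ q W ⟩
      α′ * (¼ι * (ƛ * W + W)) + (P * W * D + P * W * (u * (s * s - 2ι) - 2ι * s * (q * q - q * b)))
        ≈⟨ +-cong (*-congˡ (*-congˡ (+-congʳ (sym N≈ƛW)))) (trans (+-congˡ vanish) (+-identityʳ (P * W * D))) ⟩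
      α′ * (¼ι * (N + W)) + P * W * D ∎

open import Defs

-- Order on the Cauchy reals, and bounds for √2.

pointwise-≤ : ∀ x y → (∀ n → seq x n ℚ.≤ seq y n) → x ≤ y
pointwise-≤ x y x≤y ε 0<ε = 0 , λ n _ → ℚ.≤-trans (x≤y n)
  (≡.subst (ℚ._≤ seq y n ℚ.+ ε) (ℚ.+-identityʳ (seq y n)) (ℚ.+-monoʳ-≤ (seq y n) (ℚ.<⇒≤ 0<ε)))

≃⇒≤ : ∀ {x y} → x ≃ y → x ≤ y
≃⇒≤ {x} {y} x≃y ε 0<ε =
  let k , f = x≃y ε 0<ε
  in k , λ n n≥ → ∣-∣≤-elim (seq x n) (seq y n) (f n n≥)

≤-trans : ∀ {x y z} → x ≤ y → y ≤ z → x ≤ z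
≤-trans {x} {y} {z} x≤y y≤z ε 0<ε =
  let k , f = x≤y (½ ℚ.* ε) (pos*pos 0<½ 0<ε)
      l , g = y≤z (½ ℚ.* ε) (pos*pos 0<½ 0<ε)
  in k ℕ.⊔ l , λ n n≥ → begin
    seq x n                                   ≤⟨ f n (⊔≤ˡ n≥) ⟩
    seq y n ℚ.+ ½ ℚ.* ε                       ≤⟨ ℚ.+-monoˡ-≤ (½ ℚ.* ε) (g n (⊔≤ʳ {k} n≥)) ⟩
    seq z n ℚ.+ ½ ℚ.* ε ℚ.+ ½ ℚ.* ε           ≡⟨ ℚ.+-assoc (seq z n) (½ ℚ.* ε) (½ ℚ.* ε) ⟩
    seq z n ℚ.+ (½ ℚ.* ε ℚ.+ ½ ℚ.* ε)         ≡⟨ ≡.cong (seq z n ℚ.+_) (½+½ ε) ⟩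
    seq z n ℚ.+ ε                             ∎
  where open ℚ.≤-Reasoning

+-mono-≤ : ∀ {x y u v} → x ≤ y → u ≤ v → x + u ≤ y + v
+-mono-≤ {x} {y} {u} {v} x≤y u≤v ε 0<ε =
  let k , f = x≤y (½ ℚ.* ε) (pos*pos 0<½ 0<ε)
      l , g = u≤v (½ ℚ.* ε) (pos*pos 0<½ 0<ε)
  in k ℕ.⊔ l , λ n n≥ → begin
    seq x n ℚ.+ seq u n
      ≤⟨ ℚ.+-mono-≤ (f n (⊔≤ˡ n≥)) (g n (⊔≤ʳ {k} n≥)) ⟩
    (seq y n ℚ.+ ½ ℚ.* ε) ℚ.+ (seq v n ℚ.+ ½ ℚ.* ε)
      ≡⟨ solve 3 (λ y v h → (y :+ h) :+ (v :+ h) := (y :+ v) :+ (h :+ h)) ≡.refl (seq y n) (seq v n) (½ ℚ.* ε) ⟩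
    (seq y n ℚ.+ seq v n) ℚ.+ (½ ℚ.* ε ℚ.+ ½ ℚ.* ε)
      ≡⟨ ≡.cong (seq y n ℚ.+ seq v n ℚ.+_) (½+½ ε) ⟩
    (seq y n ℚ.+ seq v n) ℚ.+ ε ∎
  where
  open ℚ.≤-Reasoning
  open +-*-Solver

-- A nonnegative real may have negative terms; truncation gives an equal real with nonnegative
-- terms, so that products can be handled term by term.
⊔-nonNeg : ∀ {x} → 0ℝ ≤ x → x ≃ x ⊔ 0ℝ
⊔-nonNeg {x} 0≤x ε 0<ε =
  let k , f = 0≤x ε 0<ε
  in k , λ n n≥ → ∣-∣≤-intro (seq x n) (seq x n ℚ.⊔ 0ℚ)
    (ℚ.≤-trans (ℚ.p≤p⊔q (seq x n) 0ℚ) (x≤x+ε (seq x n ℚ.⊔ 0ℚ)))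
    (ℚ.⊔-lub (x≤x+ε (seq x n)) (f n n≥))
  where
  x≤x+ε : ∀ x → x ℚ.≤ x ℚ.+ ε
  x≤x+ε x = ≡.subst (ℚ._≤ x ℚ.+ ε) (ℚ.+-identityʳ x) (ℚ.+-monoʳ-≤ x (ℚ.<⇒≤ 0<ε))

0≤p*q : ∀ {p q} → 0ℚ ℚ.≤ p → 0ℚ ℚ.≤ q → 0ℚ ℚ.≤ p ℚ.* q
0≤p*q {p} {q} 0≤p 0≤q = ≡.subst (ℚ._≤ p ℚ.* q) (ℚ.*-zeroʳ p)
  (ℚ.*-monoˡ-≤-nonNeg p {{ℚ.nonNegative 0≤p}} 0≤q)

*-nonNeg : ∀ {x y} → 0ℝ ≤ x → 0ℝ ≤ y → 0ℝ ≤ x * y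
*-nonNeg {x} {y} 0≤x 0≤y = ≤-trans {0ℝ} {(x ⊔ 0ℝ) * (y ⊔ 0ℝ)} {x * y}
  (pointwise-≤ 0ℝ ((x ⊔ 0ℝ) * (y ⊔ 0ℝ)) λ n →
    0≤p*q (ℚ.p≤q⊔p (seq x n) 0ℚ) (ℚ.p≤q⊔p (seq y n) 0ℚ))
  (≃⇒≤ {(x ⊔ 0ℝ) * (y ⊔ 0ℝ)} {x * y} (≃-sym {x * y} {(x ⊔ 0ℝ) * (y ⊔ 0ℝ)}
    (*-cong {x} {x ⊔ 0ℝ} {y} {y ⊔ 0ℝ} (⊔-nonNeg {x} 0≤x) (⊔-nonNeg {y} 0≤y))))

sq-nonNeg : ∀ x → 0ℝ ≤ x * x
sq-nonNeg x = pointwise-≤ 0ℝ (x * x) λ n → 0≤q² (seq x n)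
  where
  0≤q² : ∀ q → 0ℚ ℚ.≤ q ℚ.* q
  0≤q² q with ℚ.∣p∣≡p∨∣p∣≡-p q
  ... | inj₁ e = 0≤p*q (≡.subst (0ℚ ℚ.≤_) e (ℚ.0≤∣p∣ q)) (≡.subst (0ℚ ℚ.≤_) e (ℚ.0≤∣p∣ q))
  ... | inj₂ e = ≡.subst (0ℚ ℚ.≤_)
    (solve 1 (λ q → :- q :* :- q := q :* q) ≡.refl q)
    (0≤p*q (≡.subst (0ℚ ℚ.≤_) e (ℚ.0≤∣p∣ q)) (≡.subst (0ℚ ℚ.≤_) e (ℚ.0≤∣p∣ q)))
    where open +-*-Solver

<⇒≤ : ∀ {x y} → x < y → x ≤ y
<⇒≤ {x} {y} (η , 0<η , k , f) ε 0<ε = k , λ n n≥ → begin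
  seq x n              ≡⟨ ℚ.+-identityʳ (seq x n) ⟨
  seq x n ℚ.+ 0ℚ       ≤⟨ ℚ.+-monoʳ-≤ (seq x n) (ℚ.<⇒≤ 0<η) ⟩
  seq x n ℚ.+ η        ≤⟨ f n n≥ ⟩
  seq y n              ≡⟨ ℚ.+-identityʳ (seq y n) ⟨
  seq y n ℚ.+ 0ℚ       ≤⟨ ℚ.+-monoʳ-≤ (seq y n) (ℚ.<⇒≤ 0<ε) ⟩
  seq y n ℚ.+ ε        ∎
  where open ℚ.≤-Reasoning

≤⊔ˡ : ∀ x y → x ≤ x ⊔ y
≤⊔ˡ x y = pointwise-≤ x (x ⊔ y) λ n → ℚ.p≤p⊔q (seq x n) (seq y n)

-- Either the truncation changes nothing or both sides are 0. The case distinction is made on each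
-- rational term, where the sign is decidable, and never on the real.
⊔0-idem : ∀ x → (x ⊔ 0ℝ) * (x ⊔ 0ℝ) ≃ (x ⊔ 0ℝ) * x
⊔0-idem x = pointwise ((x ⊔ 0ℝ) * (x ⊔ 0ℝ)) ((x ⊔ 0ℝ) * x) λ n → lemma (seq x n)
  where
  lemma : ∀ p → (p ℚ.⊔ 0ℚ) ℚ.* (p ℚ.⊔ 0ℚ) ≡ (p ℚ.⊔ 0ℚ) ℚ.* p
  lemma p with ℚ.≤-total 0ℚ p
  ... | inj₁ 0≤p = ≡.cong ((p ℚ.⊔ 0ℚ) ℚ.*_) (ℚ.p≥q⇒p⊔q≡p 0≤p)
  ... | inj₂ p≤0 rewrite ℚ.p≤q⇒p⊔q≡q p≤0 = ≡.sym (ℚ.*-zeroˡ p)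

1≤√2 : 1ℝ ≤ √2
1≤√2 ε 0<ε =
  let k , f = ½^-small ε 0<ε
  -- Bisection starts at 1, so index 0 gives 1 ≤ `√2-seq n` + `½^ n`.
  in k , λ n n≥ → ℚ.≤-trans (√2-seq≤ 0 n) (ℚ.+-monoʳ-≤ (√2-seq n) (f n n≥))

√2≤2 : √2 ≤ 2ℝ
-- The upper end of the initial bisection interval is 1 + 1.
√2≤2 = pointwise-≤ √2 2ℝ λ n → √2-seq≤ n 0

-- The reals as an ordered algebra, and transport of the definitions to it.

ℝᴬ : OrderedAlgebra
ℝᴬ = record
  { Carrier = ℝ
  ; _≈_ = _≃_
  ; _≤_ = _≤_
  ; _+_ = _+_
  ; _*_ = _*_
  ; -_ = -_
  ; ι = fromℚ
  ; isCommutativeRing = CommutativeRing.isCommutativeRing ℝ-commutativeRing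
  ; ι-+ = λ x y → pointwise (fromℚ (x ℚ.+ y)) (fromℚ x + fromℚ y) λ _ → ≡.refl
  ; ι-* = λ x y → pointwise (fromℚ (x ℚ.* y)) (fromℚ x * fromℚ y) λ _ → ≡.refl
  ; ι-neg = λ x → pointwise (fromℚ (ℚ.- x)) (- fromℚ x) λ _ → ≡.refl
  ; ≤-reflexive = λ {x} {y} → ≃⇒≤ {x} {y}
  ; ≤-trans = λ {x} {y} {z} → ≤-trans {x} {y} {z}
  ; +-mono-≤ = λ {x} {y} {u} {v} → +-mono-≤ {x} {y} {u} {v}
  ; *-nonNeg = λ {x} {y} → *-nonNeg {x} {y}
  ; sq-nonNeg = sq-nonNeg
  }

open OrderedAlgebra using () renaming
  ( _+_ to add ; _*_ to mul ; ι to ιᴬ ; ∑ to ∑ᴬ ; ∑⊆ to ∑⊆ᴬ ; Pr to Prᴬ ; 𝔼 to 𝔼ᴬ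
  ; revenue to revenueᴬ ; revenueIE to revenueIEᴬ ; revenue≤¼[N+W] to revenueᴬ≤¼[N+W]
  ; 𝔼-revenueIE to 𝔼-revenueIEᴬ ; approximation to approximationᴬ )
open Sum (CommutativeRing.semiring ℝ-commutativeRing) using (sum-cong-≋)
open Product (CommutativeRing.*-monoid ℝ-commutativeRing) using () renaming (sum-cong-≋ to product-cong)

-- The two additions are convertible; the projected one is written on the right so that the results
-- of the abstract development match syntactically.
+-transport : ∀ {x y u v} → x ≃ y → u ≃ v → x + u ≃ add ℝᴬ y v
+-transport {x} {y} {u} {v} = +-cong {x} {y} {u} {v}

*-transport : ∀ {x y u v} → x ≃ y → u ≃ v → x * u ≃ mul ℝᴬ y v
*-transport {x} {y} {u} {v} = *-cong {x} {y} {u} {v}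

if-cong : ∀ b {x y u v} → x ≃ y → u ≃ v → (if b then x else u) ≃ (if b then y else v)
if-cong true  x≃y _   = x≃y
if-cong false _   u≃v = u≃v

∑-transport : ∀ {n} {P : Pred (Fin n) 0ℓ} (P? : Decidable P) (f g : Fin n → ℝ) →
              (∀ i → f i ≃ g i) → ∑ P? f ≃ ∑ᴬ ℝᴬ P? g
∑-transport P? f g f≃g = sum-cong-≋ λ i → if-cong (does (P? i)) (f≃g i) (≃-refl {0ℝ})

∑⊆-cong : ∀ n {f g : Subset n → ℝ} → (∀ A → f A ≃ g A) → ∑⊆ n f ≃ ∑⊆ᴬ ℝᴬ n g
∑⊆-cong zero    f≃g = f≃g []
∑⊆-cong (suc n) {f} {g} f≃g = +-cong
  {∑⊆ n (f ∘ (inside ∷_))} {∑⊆ᴬ ℝᴬ n (g ∘ (inside ∷_))}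
  {∑⊆ n (f ∘ (outside ∷_))} {∑⊆ᴬ ℝᴬ n (g ∘ (outside ∷_))}
  (∑⊆-cong n (f≃g ∘ (inside ∷_))) (∑⊆-cong n (f≃g ∘ (outside ∷_)))

Pr≃ : ∀ {n} q (A : Subset n) → Pr q A ≃ Prᴬ ℝᴬ q A
Pr≃ q A = product-cong λ i → if-cong (does (i ∈? A)) (≃-refl {q}) (≃-refl {1ℝ - q})

N≃ƛW : ∀ N W (0<W : 0ℝ < W) → N ≃ N * recipℝ W 0<W * W
N≃ƛW N W 0<W = ≃-sym {N * r * W} {N} (≃-trans {N * r * W} {N * (W * r)} {N}
  (pointwise (N * r * W) (N * (W * r)) λ n → rearrange (seq N n) (seq r n) (seq W n))
  (≃-trans {N * (W * r)} {N * 1ℝ} {N}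
    (*-cong {N} {N} {W * r} {1ℝ} (≃-refl {N}) (*-recipℝ W 0<W))
    (pointwise (N * 1ℝ) N λ n → ℚ.*-identityʳ (seq N n))))
  where
  r = recipℝ W 0<W
  open +-*-Solver
  rearrange : ∀ N r W → N ℚ.* r ℚ.* W ≡ N ℚ.* (W ℚ.* r)
  rearrange = solve 3 (λ N r W → N :* r :* W := N :* (W :* r)) ≡.refl

-- Bounds for networks with real weights.

module _ {n} (G : Network n) where
  open Network G

  revenue≃ : ∀ s → revenue G s ≃
    revenueᴬ ℝᴬ w w-sym w-nonNeg (Strategy.position s) (Strategy.p s)
  revenue≃ s = sum-cong-≋ λ i → ≃-refl
    {p i * (1ℝ - p i) * (w i i + ∑ (λ j → position j Fin.<? position i) λ j → p j * w j i)}
    where open Strategy s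

  -- The abbreviations are let-bound since a defined name would not match syntactically.
  revenueIE≃ : ∀ p A → revenueIE G A p ≃ revenueIEᴬ ℝᴬ w w-sym w-nonNeg (p * (1ℝ - p)) p A
  revenueIE≃ p A =
    let free      = λ j → j ∈? A
        earlier   = λ i j → ¬? (j ∈? A) ×-dec ¬? (j Fin.≟ i)
        fromFree  = λ i → w i i + ∑ free (λ j → w j i)
        fromFree′ = λ i → add ℝᴬ (w i i) (∑ᴬ ℝᴬ free λ j → w j i)
        half      = λ i j → p * w j i * fromℚ ½
        half′     = λ i j → mul ℝᴬ (mul ℝᴬ p (w j i)) (ιᴬ ℝᴬ ½)
        income    = λ i → fromFree i + ∑ (earlier i) (half i)
        income′   = λ i → add ℝᴬ (fromFree′ i) (∑ᴬ ℝᴬ (earlier i) (half′ i))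
    in *-transport {p * (1ℝ - p)} {p * (1ℝ - p)}
         {∑ (λ i → ¬? (i ∈? A)) income} {∑ᴬ ℝᴬ (λ i → ¬? (i ∈? A)) income′}
         (≃-refl {p * (1ℝ - p)})
         (∑-transport (λ i → ¬? (i ∈? A)) income income′ λ i →
           +-transport {fromFree i} {fromFree′ i} {∑ (earlier i) (half i)} {∑ᴬ ℝᴬ (earlier i) (half′ i)}
             (≃-refl {fromFree i})
             (∑-transport (earlier i) (half i) (half′ i) λ j → ≃-refl {half i j}))

  expectedRevenueIE≃ : ∀ q p →
    expectedRevenueIE G q p ≃ 𝔼ᴬ ℝᴬ q n (revenueIEᴬ ℝᴬ w w-sym w-nonNeg (p * (1ℝ - p)) p)
  expectedRevenueIE≃ q p = ∑⊆-cong n λ A → *-transport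
    {Pr q A} {Prᴬ ℝᴬ q A}
    {revenueIE G A p} {revenueIEᴬ ℝᴬ w w-sym w-nonNeg (p * (1ℝ - p)) p A}
    (Pr≃ q A) (revenueIE≃ p A)

  revenue≤¼[N+W] : ∀ s → revenue G s ≤ fromℚ (+ 1 / 4) * (N G + W G)
  revenue≤¼[N+W] s = ≤-trans {revenue G s}
    {revenueᴬ ℝᴬ w w-sym w-nonNeg (Strategy.position s) (Strategy.p s)} {fromℚ (+ 1 / 4) * (N G + W G)}
    (≃⇒≤ {revenue G s} {revenueᴬ ℝᴬ w w-sym w-nonNeg (Strategy.position s) (Strategy.p s)} (revenue≃ s))
    (revenueᴬ≤¼[N+W] ℝᴬ w w-sym w-nonNeg
      {Strategy.position s} position-injective {Strategy.p s} ½≤p p≤1)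
    where
    open Strategy s
    position-injective : Injective _≡_ _≡_ position
    position-injective {i} {j} e = ≡.trans (≡.sym (inverseˡ π)) (≡.trans (≡.cong (π ⟨$⟩ˡ_) e) (inverseˡ π))

  expectedRevenueIE-value : ∀ q p → expectedRevenueIE G q p ≃
    p * (1ℝ - p) * ((1ℝ - q) * N G + (1ℝ - q) * (q + (1ℝ - q) * (p * fromℚ ½)) * (W G + W G))
  expectedRevenueIE-value q p = ≃-trans {expectedRevenueIE G q p}
    {𝔼ᴬ ℝᴬ q n (revenueIEᴬ ℝᴬ w w-sym w-nonNeg (p * (1ℝ - p)) p)}
    {p * (1ℝ - p) * ((1ℝ - q) * N G + (1ℝ - q) * (q + (1ℝ - q) * (p * fromℚ ½)) * (W G + W G))}
    (expectedRevenueIE≃ q p)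
    (𝔼-revenueIEᴬ ℝᴬ w w-sym w-nonNeg q (p * (1ℝ - p)) p)

  -- The abstract comparison at s = √2 and q = a ⊔ 0: `≤⊔ˡ` provides a ≤ q, and `⊔0-idem` provides
  -- q² = q a.
  α*revenue≤revIE : (W>0 : 0ℝ < W G) →
    let ƛ = N G * recipℝ (W G) W>0
        q = (1ℝ - √2 * (2ℝ + ƛ) * fromℚ (+ 1 / 4)) ⊔ 0ℝ
        α = 2ℝ * √2 * (2ℝ - √2) * (√2 - 1ℝ)
        revIE = expectedRevenueIE G q (2ℝ - √2)
    in ∀ s → α * revenue G s ≤ revIE
  α*revenue≤revIE W>0 s =
    let ƛ = N G * recipℝ (W G) W>0
        a = 1ℝ - √2 * (2ℝ + ƛ) * fromℚ (+ 1 / 4)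
        α = 2ℝ * √2 * (2ℝ - √2) * (√2 - 1ℝ)
    in approximationᴬ ℝᴬ
      {√2} {ƛ} {a} {a ⊔ 0ℝ} {N G} {W G} {α} {revenue G s} {expectedRevenueIE G (a ⊔ 0ℝ) (2ℝ - √2)}
      √2*√2≃2 1≤√2 √2≤2 (<⇒≤ {0ℝ} {W G} W>0) (N≃ƛW (N G) (W G) W>0) (≃-refl {a}) (≤⊔ˡ a 0ℝ) (⊔0-idem a)
      (≃-refl {α}) (revenue≤¼[N+W] s) (expectedRevenueIE-value (a ⊔ 0ℝ) (2ℝ - √2))

proposition1 :
    ∀ {n} (G : Network n) (W>0 : 0ℝ < W G) →
    let ƛ = N G * recipℝ (W G) W>0
        q = (1ℝ - √2 * (2ℝ + ƛ) * fromℚ (+ 1 / 4)) ⊔ 0ℝ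
        α = 2ℝ * √2 * (2ℝ - √2) * (√2 - 1ℝ)
        revIE = expectedRevenueIE G q (2ℝ - √2)
    in (∀ (s : Strategy n) → α * revenue G s ≤ revIE)
       × (∀ Rmax → IsMaximum (revenue G) Rmax → α * Rmax ≤ revIE)
proposition1 G W>0 =
  let ƛ = N G * recipℝ (W G) W>0
      q = (1ℝ - √2 * (2ℝ + ƛ) * fromℚ (+ 1 / 4)) ⊔ 0ℝ
      α = 2ℝ * √2 * (2ℝ - √2) * (√2 - 1ℝ)
      revIE = expectedRevenueIE G q (2ℝ - √2)
  -- A maximum is attained at some `s`, so the bound for strategies carries over to `Rmax`.
  in α*revenue≤revIE G W>0 , λ Rmax (_ , s , e) →
    ≤-trans {α * Rmax} {α * revenue G s} {revIE}
      (≃⇒≤ {α * Rmax} {α * revenue G s}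
        (*-cong {α} {α} {Rmax} {revenue G s} (≃-refl {α}) (≃-sym {revenue G s} {Rmax} e)))
      (α*revenue≤revIE G W>0 s)
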